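{- Let $(\mathbb A,\mathbb B)$ be a PCSP template and let $\mathcal R$ be the minion describing BLP. Then $\mathrm{PCSP}(\mathbb A,\mathbb B)$ is solved by some level of the Sherali–Adams hierarchy if and only if there is a minion homomorphism $\mathrm{lvl}_k\,\mathcal R\to\mathrm{Pol}(\mathbb A,\mathbb B)$ for some $k\in\mathbb N$ ($k\ge1$).
   Context: An LC (label cover) instance $\mathcal D$ consists of a finite set $X$ of variables, a finite set $\mathcal D_x$ (domain) for each $x\in X$, and a finite list of constraints of the form $x=\alpha(y)$ with $x,y\in X$ and $\alpha:\mathcal D_y\to\mathcal D_x$ a function; it is discrete if it has no constraints. A minion $\mathcal R$ is a functor from finite sets to sets: it assigns a set $\mathcal R^{(D)}$ to each finite set $D$ and a map $\mathcal R^{(\alpha)}:\mathcal R^{(D)}\to\mathcal R^{(E)}$ to each function $\alpha:D\to E$ between finite sets, preserving identities and composition. A solution of $\mathcal D$ in $\mathcal R$ is a tuple $(r_x)_{x\in X}$ with $r_x\in\mathcal R^{(\mathcal D_x)}$ and $r_x=\mathcal R^{(\alpha)}(r_y)$ for every constraint $x=\alpha(y)$ of $\mathcal D$. A minion homomorphism is a natural transformation between minions. The minion $\mathcal R$ describing BLP (basic linear programming relaxation): $\mathcal R^{(D)}=\{f:D\to[0,1]\mid\sum_{a\in D}f(a)=1\}$ (real interval), and for $\alpha:D\to E$, $\mathcal R^{(\alpha)}(f)(b)=\sum_{a\in\alpha^{ -1}(b)}f(a)$. The $k$-th saturated power $\mathrm{pow}_k\,\mathcal D$ is the LC instance with variable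 set $X^k$, domains $\mathcal D_{x_1x_2\dots x_k}=\mathcal D_{x_1}\times\cdots\times\mathcal D_{x_k}$, and the following constraints, where first all constraints $x=\mathrm{id}(x)$ ($x\in X$) are added to $\mathcal D$: (1) for every $k$-tuple of constraints $x_i=\alpha_i(y_i)$, $i=1,\dots,k$, of $\mathcal D$, the constraint $x_1\dots x_k=(\alpha_1\times\cdots\times\alpha_k)(y_1\dots y_k)$; (2) for every $x_1\dots x_k\in X^k$ and every function $\sigma:[k]\to[k]$, the constraint $x_{\sigma(1)}\dots x_{\sigma(k)}=\sigma^*(x_1\dots x_k)$, where $\sigma^*(d_1\dots d_k)=d_{\sigma(1)}\dots d_{\sigma(k)}$. The $k$-th level $\mathrm{lvl}_k\,\mathcal R$ of a minion $\mathcal R$ is the minion defined as follows. Elements of $(\mathrm{lvl}_k\,\mathcal R)^{(C)}$ are triples $(\mathcal E,r,\omega)$ where $\mathcal E$ is a discrete LC instance with variable set $Y$; $r=(r_{\bar y})_{\bar y\in Y^k}$ is a solution of $\mathrm{pow}_k\,\mathcal E$ in $\mathcal R$; and $\omega=(\omega_{\bar y})_{\bar y\in Y^{k-1}}$ is a tuple with $\omega_{\bar y}\in\mathcal R^{(C\times\mathcal E_{y_1}\times\cdots\times\mathcal E_{y_{k-1}})}$ such that there exist $z\in Y$ and a map $\beta:\mathcal E_z\to C$ with $\omega_{\bar y}=\mathcal R^{(\beta\times\mathrm{id}\times\cdots\times\mathrm{id})}(r_{zy_1\dots y_{k-1}})$ for all $\bar y\in Y^{k-1}$. For $\alpha:C\to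 C'$, $(\mathrm{lvl}_k\,\mathcal R)^{(\alpha)}(\mathcal E,r,\omega)=(\mathcal E,r,\omega')$ with $\omega'_{\bar y}=\mathcal R^{(\alpha\times\mathrm{id}\times\cdots\times\mathrm{id})}(\omega_{\bar y})$. A structure $\mathbb A$ in a finite signature $\Sigma$ (a finite set of relation symbols $R$ with arities $\mathrm{ar}(R)\ge1$) consists of a nonempty finite set $A$ and a relation $R^{\mathbb A}\subseteq A^{\mathrm{ar}(R)}$ for each $R\in\Sigma$. A homomorphism is a relation-preserving map. A PCSP template is a pair $(\mathbb A,\mathbb B)$ of structures in the same finite signature such that there is a homomorphism $\mathbb A\to\mathbb B$. An instance $\mathcal I$ of $\mathrm{PCSP}(\mathbb A,\mathbb B)$ is a finite list of formal constraints $x_1\dots x_n\in R$ with $R\in\Sigma$, $n=\mathrm{ar}(R)$, and $x_i$ variables. A solution of $\mathcal I$ in $\mathbb B$ is a map $s$ from variables to $B$ with $s(x_1)\dots s(x_n)\in R^{\mathbb B}$ for each constraint. The polymorphism minion $\mathcal M=\mathrm{Pol}(\mathbb A,\mathbb B)$: $\mathcal M^{(D)}$ is the set of homomorphisms from the Cartesian power $\mathbb A^D$ (relations taken coordinatewise) to $\mathbb B$; for $\alpha:D\to E$ and $f\in\mathcal M^{(D)}$, $\mathcal M^{(\alpha)}(f):\mathbb A^E\to\mathbb B$ is $a\mapsto f(a\circ\alpha)$. Sherali–Adams: for $m\ge1$, the LC instance $\mathrm{lc}_{\mathbb A}^m(\mathcal I)$ has as variables the sets $U$ of at most $m$ variables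 of $\mathcal I$; the domain of $U$ is the set of partial solutions on $U$, i.e. functions $f:U\to A$ satisfying $f(x_1)\dots f(x_n)\in R^{\mathbb A}$ for every constraint $x_1\dots x_n\in R$ of $\mathcal I$ with all $x_i\in U$; and for every inclusion $U\subseteq U'$ there is the constraint $U=\mathrm{res}(U')$, where $\mathrm{res}(f)=f|_U$. $\mathrm{PCSP}(\mathbb A,\mathbb B)$ is solved by the $m$-th level of the Sherali–Adams hierarchy if for every instance $\mathcal I$: if $\mathrm{lc}_{\mathbb A}^m(\mathcal I)$ has a solution in the BLP minion, then $\mathcal I$ has a solution in $\mathbb B$. "Some level" means that such an $m\ge1$ exists (independent of $\mathcal I$). -}

module Defs where

open import Algebra.Bundles using (CommutativeMonoid)
open import Data.Bool.Base using (Bool; true; false)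
import Data.Bool.Properties as Bool
open import Data.Fin.Base using (Fin; zero; suc)
import Data.Fin.Properties as Fin
open import Data.Fin.Subset using (Subset; Side; inside; outside; _∈_; _⊆_; ∣_∣; ⁅_⁆; ⋃)
open import Data.Fin.Subset.Properties using (_⊆?_; drop-∷-⊆)
import Data.Fin.Subset.Properties as Subset
open import Data.Irrelevant using ([_])
open import Data.List.Base as List
  using (List; []; _∷_; _++_; filter; concatMap; cartesianProduct; cartesianProductWith; allFin)
import Data.List.Membership.Propositional as ListMem
open import Data.List.Membership.Propositional.Properties
  using (∈-cartesianProduct⁺; ∈-cartesianProductWith⁺; ∈-allFin)
open import Data.List.Relation.Unary.All as ListAll using ([]; _∷_)
import Data.List.Relation.Unary.All.Properties as ListAll
open import Data.List.Relation.Unary.AllPairs using ([]; _∷_)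
open import Data.List.Relation.Unary.Any using (here; there)
open import Data.List.Relation.Unary.Unique.Propositional using (Unique)
open import Data.List.Relation.Unary.Unique.Propositional.Properties
  using (cartesianProduct⁺; cartesianProductWith⁺; allFin⁺)
open import Data.Nat.Base as ℕ using (ℕ; zero; suc; NonZero)
import Data.Nat.Properties as ℕ
open import Data.Product.Base using (Σ; Σ-syntax; ∃; ∃-syntax; _×_; _,_; proj₁; proj₂)
open import Data.Product.Properties using (≡-dec)
open import Data.Rational.Base as ℚ using (ℚ; 0ℚ; 1ℚ; ½)
import Data.Rational.Properties as ℚ
open import Data.Refinement.Base as Refinement using (Refinement; value)
open import Data.Sum.Base using (inj₁; inj₂)
open import Data.Unit.Base using (⊤; tt)
import Data.Unit.Properties as Unit
open import Data.Vec.Base as Vec using (Vec; []; _∷_; lookup; here; there; _[_]=_)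
open import Data.Vec.Properties.WithK using ([]=-irrelevant)
import Data.Vec.Properties as Vec
open import Data.Vec.Relation.Unary.All as All using (All; []; _∷_)
open import Function.Base using (id; _∘_; const)
open import Function.Bundles using (Func)
open import Level using (Level; _⊔_; 0ℓ) renaming (suc to lsuc)
open import Relation.Binary.Bundles using (Setoid)
open import Relation.Binary.Definitions using (DecidableEquality)
open import Relation.Binary.PropositionalEquality
  using (_≡_; _≗_; refl; sym; trans; cong; cong₂; subst; subst₂)
open import Relation.Nullary using (¬_; Dec; yes; no; contradiction; _×-dec_)
open import Relation.Unary using (Pred; Decidable)
import Relation.Nullary.Decidable as Dec

private
  variable
    c ℓ c′ ℓ′ : Level

------------------------------------------------------------------------
-- Real numbers

-- Cauchy sequences of rationals; two sequences denote the same real when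
-- their difference tends to 0.  Only the additive ordered structure is
-- needed.

record ℝ : Set where
  field
    seq    : ℕ → ℚ
    cauchy : ∀ ε → 0ℚ ℚ.< ε →
             ∃[ N ] ∀ m n → N ℕ.≤ m → N ℕ.≤ n → ℚ.∣ seq m ℚ.- seq n ∣ ℚ.< ε
open ℝ public

infix  4 _≈ℝ_ _≤ℝ_
infixl 6 _+ℝ_

_≈ℝ_ : ℝ → ℝ → Set
x ≈ℝ y = ∀ ε → 0ℚ ℚ.< ε → ∃[ N ] ∀ n → N ℕ.≤ n → ℚ.∣ seq x n ℚ.- seq y n ∣ ℚ.< ε

_≤ℝ_ : ℝ → ℝ → Set
x ≤ℝ y = ∀ ε → 0ℚ ℚ.< ε → ∃[ N ] ∀ n → N ℕ.≤ n → seq x n ℚ.< seq y n ℚ.+ ε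

module ℚ-lemmas where
  open import Data.Rational.Solver using (module +-*-Solver)
  open +-*-Solver

  half+half : ∀ ε → ½ ℚ.* ε ℚ.+ ½ ℚ.* ε ≡ ε
  half+half ε = trans (sym (ℚ.*-distribʳ-+ ε ½ ½)) (ℚ.*-identityˡ ε)

  0<half : ∀ {ε} → 0ℚ ℚ.< ε → 0ℚ ℚ.< ½ ℚ.* ε
  0<half {ε} 0<ε = subst (ℚ._< ½ ℚ.* ε) (ℚ.*-zeroʳ ½) (ℚ.*-monoʳ-<-pos ½ 0<ε)

  minus-swap : ∀ a b → ℚ.- (a ℚ.- b) ≡ b ℚ.- a
  minus-swap = solve 2 (λ a b → :- (a :- b) := b :- a) refl

  abs-swap : ∀ a b → ℚ.∣ a ℚ.- b ∣ ≡ ℚ.∣ b ℚ.- a ∣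
  abs-swap a b = trans (sym (ℚ.∣-p∣≡∣p∣ (a ℚ.- b))) (cong ℚ.∣_∣ (minus-swap a b))

  abs-self : ∀ a {ε} → 0ℚ ℚ.< ε → ℚ.∣ a ℚ.- a ∣ ℚ.< ε
  abs-self a {ε} 0<ε = subst (λ q → ℚ.∣ q ∣ ℚ.< ε) (sym (ℚ.+-inverseʳ a)) 0<ε

  add-bounds : ∀ {ε} p q {s} → s ≡ p ℚ.+ q → ℚ.∣ p ∣ ℚ.< ½ ℚ.* ε → ℚ.∣ q ∣ ℚ.< ½ ℚ.* ε →
               ℚ.∣ s ∣ ℚ.< ε
  add-bounds {ε} p q refl p< q< =
    ℚ.≤-<-trans (ℚ.∣p+q∣≤∣p∣+∣q∣ p q)
      (subst (ℚ.∣ p ∣ ℚ.+ ℚ.∣ q ∣ ℚ.<_) (half+half ε) (ℚ.+-mono-< p< q<))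

  abs-triangle : ∀ {ε} a b c → ℚ.∣ a ℚ.- b ∣ ℚ.< ½ ℚ.* ε → ℚ.∣ b ℚ.- c ∣ ℚ.< ½ ℚ.* ε →
                 ℚ.∣ a ℚ.- c ∣ ℚ.< ε
  abs-triangle a b c =
    add-bounds (a ℚ.- b) (b ℚ.- c)
      (solve 3 (λ a b c → a :- c := (a :- b) :+ (b :- c)) refl a b c)

  abs-add : ∀ {ε} a a′ b b′ → ℚ.∣ a ℚ.- a′ ∣ ℚ.< ½ ℚ.* ε → ℚ.∣ b ℚ.- b′ ∣ ℚ.< ½ ℚ.* ε →
            ℚ.∣ (a ℚ.+ b) ℚ.- (a′ ℚ.+ b′) ∣ ℚ.< ε
  abs-add a a′ b b′ =
    add-bounds (a ℚ.- a′) (b ℚ.- b′)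
      (solve 4 (λ a a′ b b′ → (a :+ b) :- (a′ :+ b′) := (a :- a′) :+ (b :- b′)) refl a a′ b b′)

  p≤∣p∣ : ∀ p → p ℚ.≤ ℚ.∣ p ∣
  p≤∣p∣ p with ℚ.≤-total 0ℚ p
  ... | inj₁ 0≤p = ℚ.≤-reflexive (sym (ℚ.0≤p⇒∣p∣≡p 0≤p))
  ... | inj₂ p≤0 = ℚ.≤-trans p≤0 (ℚ.0≤∣p∣ p)

  abs⇒< : ∀ {ε} a b → ℚ.∣ a ℚ.- b ∣ ℚ.< ε → a ℚ.< b ℚ.+ ε
  abs⇒< {ε} a b h =
    subst (ℚ._< b ℚ.+ ε) (solve 2 (λ a b → b :+ (a :- b) := a) refl a b)
      (ℚ.+-monoʳ-< b (ℚ.≤-<-trans (p≤∣p∣ (a ℚ.- b)) h))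

  <-triangle : ∀ {ε} a b c → a ℚ.< b ℚ.+ ½ ℚ.* ε → b ℚ.< c ℚ.+ ½ ℚ.* ε → a ℚ.< c ℚ.+ ε
  <-triangle {ε} a b c a<b b<c =
    ℚ.<-trans a<b
      (subst (b ℚ.+ ½ ℚ.* ε ℚ.<_)
        (trans (ℚ.+-assoc c _ _) (cong (c ℚ.+_) (half+half ε)))
        (ℚ.+-monoˡ-< (½ ℚ.* ε) b<c))

  <-add : ∀ {ε} a a′ b b′ → a ℚ.< a′ ℚ.+ ½ ℚ.* ε → b ℚ.< b′ ℚ.+ ½ ℚ.* ε →
          a ℚ.+ b ℚ.< (a′ ℚ.+ b′) ℚ.+ ε
  <-add {ε} a a′ b b′ h h′ =
    subst (a ℚ.+ b ℚ.<_)
      (trans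
        (solve 3 (λ a′ b′ e → (a′ :+ e) :+ (b′ :+ e) := (a′ :+ b′) :+ (e :+ e)) refl a′ b′ (½ ℚ.* ε))
        (cong ((a′ ℚ.+ b′) ℚ.+_) (half+half ε)))
      (ℚ.+-mono-< h h′)

open ℚ-lemmas

private
  module _ {N N′ : ℕ} where
    ⊔ˡ : ∀ {n} → N ℕ.⊔ N′ ℕ.≤ n → N ℕ.≤ n
    ⊔ˡ = ℕ.≤-trans (ℕ.m≤m⊔n N N′)

    ⊔ʳ : ∀ {n} → N ℕ.⊔ N′ ℕ.≤ n → N′ ℕ.≤ n
    ⊔ʳ = ℕ.≤-trans (ℕ.m≤n⊔m N N′)

fromℚ : ℚ → ℝ
fromℚ q = record
  { seq    = const q
  ; cauchy = λ ε 0<ε → 0 , λ _ _ _ _ → abs-self q 0<ε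
  }

0ℝ 1ℝ : ℝ
0ℝ = fromℚ 0ℚ
1ℝ = fromℚ 1ℚ

_+ℝ_ : ℝ → ℝ → ℝ
x +ℝ y = record
  { seq    = λ n → seq x n ℚ.+ seq y n
  ; cauchy = λ ε 0<ε →
      let N  , h  = cauchy x (½ ℚ.* ε) (0<half 0<ε)
          N′ , h′ = cauchy y (½ ℚ.* ε) (0<half 0<ε)
      in N ℕ.⊔ N′ , λ m n N≤m N≤n →
           abs-add (seq x m) (seq x n) (seq y m) (seq y n)
             (h m n (⊔ˡ N≤m) (⊔ˡ N≤n)) (h′ m n (⊔ʳ N≤m) (⊔ʳ N≤n))
  }

≗⇒≈ℝ : ∀ {x y} → seq x ≗ seq y → x ≈ℝ y
≗⇒≈ℝ {x} {y} eq ε 0<ε =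
  0 , λ n _ → subst (λ q → ℚ.∣ seq x n ℚ.- q ∣ ℚ.< ε) (eq n) (abs-self (seq x n) 0<ε)

ℝ-+-0-commutativeMonoid : CommutativeMonoid 0ℓ 0ℓ
ℝ-+-0-commutativeMonoid = record
  { Carrier = ℝ
  ; _≈_     = _≈ℝ_
  ; _∙_     = _+ℝ_
  ; ε       = 0ℝ
  ; isCommutativeMonoid = record
    { isMonoid = record
      { isSemigroup = record
        { isMagma = record
          { isEquivalence = record
            { refl  = λ {x} → ≗⇒≈ℝ {x} {x} (λ _ → refl)
            ; sym   = λ {x} {y} x≈y ε 0<ε →
                let N , h = x≈y ε 0<ε
                in N , λ n N≤n → subst (ℚ._< ε) (abs-swap (seq x n) (seq y n)) (h n N≤n)
            ; trans = λ {x} {y} {z} x≈y y≈z ε 0<ε →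
                let N  , h  = x≈y (½ ℚ.* ε) (0<half 0<ε)
                    N′ , h′ = y≈z (½ ℚ.* ε) (0<half 0<ε)
                in N ℕ.⊔ N′ , λ n N≤n →
                     abs-triangle (seq x n) (seq y n) (seq z n) (h n (⊔ˡ N≤n)) (h′ n (⊔ʳ N≤n))
            }
          ; ∙-cong = λ {x} {x′} {y} {y′} x≈x′ y≈y′ ε 0<ε →
              let N  , h  = x≈x′ (½ ℚ.* ε) (0<half 0<ε)
                  N′ , h′ = y≈y′ (½ ℚ.* ε) (0<half 0<ε)
              in N ℕ.⊔ N′ , λ n N≤n →
                   abs-add (seq x n) (seq x′ n) (seq y n) (seq y′ n) (h n (⊔ˡ N≤n)) (h′ n (⊔ʳ N≤n))
          }
        ; assoc = λ x y z → ≗⇒≈ℝ {(x +ℝ y) +ℝ z} {x +ℝ (y +ℝ z)}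
                    (λ n → ℚ.+-assoc (seq x n) (seq y n) (seq z n))
        }
      ; identity = (λ x → ≗⇒≈ℝ {0ℝ +ℝ x} {x} (λ n → ℚ.+-identityˡ (seq x n)))
                 , (λ x → ≗⇒≈ℝ {x +ℝ 0ℝ} {x} (λ n → ℚ.+-identityʳ (seq x n)))
      }
    ; comm = λ x y → ≗⇒≈ℝ {x +ℝ y} {y +ℝ x} (λ n → ℚ.+-comm (seq x n) (seq y n))
    }
  }

ℝ-setoid : Setoid 0ℓ 0ℓ
ℝ-setoid = CommutativeMonoid.setoid ℝ-+-0-commutativeMonoid

module ≈ℝ = CommutativeMonoid ℝ-+-0-commutativeMonoid

≈ℝ⇒≤ℝ : ∀ {x y} → x ≈ℝ y → x ≤ℝ y
≈ℝ⇒≤ℝ {x} {y} x≈y ε 0<ε =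
  let N , h = x≈y ε 0<ε
  in N , λ n N≤n → abs⇒< (seq x n) (seq y n) (h n N≤n)

≤ℝ-trans : ∀ {x y z} → x ≤ℝ y → y ≤ℝ z → x ≤ℝ z
≤ℝ-trans {x} {y} {z} x≤y y≤z ε 0<ε =
  let N  , h  = x≤y (½ ℚ.* ε) (0<half 0<ε)
      N′ , h′ = y≤z (½ ℚ.* ε) (0<half 0<ε)
  in N ℕ.⊔ N′ , λ n N≤n →
       <-triangle (seq x n) (seq y n) (seq z n) (h n (⊔ˡ N≤n)) (h′ n (⊔ʳ N≤n))

+ℝ-mono-≤ℝ : ∀ {x x′ y y′} → x ≤ℝ x′ → y ≤ℝ y′ → x +ℝ y ≤ℝ x′ +ℝ y′
+ℝ-mono-≤ℝ {x} {x′} {y} {y′} x≤x′ y≤y′ ε 0<ε =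
  let N  , h  = x≤x′ (½ ℚ.* ε) (0<half 0<ε)
      N′ , h′ = y≤y′ (½ ℚ.* ε) (0<half 0<ε)
  in N ℕ.⊔ N′ , λ n N≤n →
       <-add (seq x n) (seq x′ n) (seq y n) (seq y′ n) (h n (⊔ˡ N≤n)) (h′ n (⊔ʳ N≤n))

∑ : {A : Set} → List A → (A → ℝ) → ℝ
∑ xs f = List.foldr _+ℝ_ 0ℝ (List.map f xs)

------------------------------------------------------------------------
-- Finite sets

record FinSet : Set₁ where
  field
    Carrier  : Set
    elements : List Carrier
    complete : ∀ x → x ListMem.∈ elements
    unique   : Unique elements
    _≟_      : DecidableEquality Carrier

open FinSet public using (elements; complete; unique)

⌊_⌋ : FinSet → Set
⌊_⌋ = FinSet.Carrier

⊤ᶠ : FinSet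
⊤ᶠ = record
  { Carrier = ⊤ ; elements = tt ∷ [] ; complete = λ _ → here refl ; unique = [] ∷ [] ; _≟_ = Unit._≟_ }

Sideᶠ : FinSet
Sideᶠ = record
  { Carrier  = Side
  ; elements = true ∷ false ∷ []
  ; complete = λ { true → here refl ; false → there (here refl) }
  ; unique   = ((λ ()) ∷ []) ∷ [] ∷ []
  ; _≟_      = Bool._≟_
  }

Finᶠ : ℕ → FinSet
Finᶠ n = record
  { Carrier  = Fin n
  ; elements = allFin n
  ; complete = ∈-allFin
  ; unique   = allFin⁺ n
  ; _≟_      = Fin._≟_
  }

_×ᶠ_ : FinSet → FinSet → FinSet
D ×ᶠ E = record
  { Carrier  = ⌊ D ⌋ × ⌊ E ⌋
  ; elements = cartesianProduct (elements D) (elements E)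
  ; complete = λ (x , y) → ∈-cartesianProduct⁺ (complete D x) (complete E y)
  ; unique   = cartesianProduct⁺ (unique D) (unique E)
  ; _≟_      = ≡-dec (FinSet._≟_ D) (FinSet._≟_ E)
  }

vectors : {A : Set} → List A → ∀ k → List (Vec A k)
vectors xs zero    = [] ∷ []
vectors xs (suc k) = cartesianProductWith _∷_ xs (vectors xs k)

_^ᶠ_ : FinSet → ℕ → FinSet
D ^ᶠ k = record
  { Carrier  = Vec ⌊ D ⌋ k
  ; elements = vectors (elements D) k
  ; complete = vectors-complete
  ; unique   = vectors-unique k
  ; _≟_      = Vec.≡-dec (FinSet._≟_ D)
  }
  where
  vectors-complete : ∀ {k} (v : Vec ⌊ D ⌋ k) → v ListMem.∈ vectors (elements D) k
  vectors-complete []      = here refl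
  vectors-complete (x ∷ v) = ∈-cartesianProductWith⁺ _∷_ (complete D x) (vectors-complete v)

  vectors-unique : ∀ k → Unique (vectors (elements D) k)
  vectors-unique zero    = [] ∷ []
  vectors-unique (suc k) = cartesianProductWith⁺ _∷_ Vec.∷-injective (unique D) (vectors-unique k)

-- The product F x₁ × ⋯ × F xₖ for a vector x₁ … xₖ.

Πᶠ : {X : Set} (F : X → FinSet) → ∀ {k} → Vec X k → FinSet
Πᶠ {X} F xs = record
  { Carrier  = All (⌊_⌋ ∘ F) xs
  ; elements = tuples xs
  ; complete = tuples-complete
  ; unique   = tuples-unique xs
  ; _≟_      = tuples-≟
  }
  where
  tuples : ∀ {k} (xs : Vec X k) → List (All (⌊_⌋ ∘ F) xs)
  tuples []       = [] ∷ []
  tuples (x ∷ xs) = cartesianProductWith _∷_ (elements (F x)) (tuples xs)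

  ∷-inj : ∀ {k x} {xs : Vec X k} {d d′ : ⌊ F x ⌋} {ds ds′ : All (⌊_⌋ ∘ F) xs} →
          _≡_ {A = All (⌊_⌋ ∘ F) (x ∷ xs)} (d ∷ ds) (d′ ∷ ds′) → d ≡ d′ × ds ≡ ds′
  ∷-inj eq = cong All.head eq , cong All.tail eq

  tuples-complete : ∀ {k} {xs : Vec X k} (ds : All (⌊_⌋ ∘ F) xs) → ds ListMem.∈ tuples xs
  tuples-complete []               = here refl
  tuples-complete {xs = x ∷ _} (d ∷ ds) =
    ∈-cartesianProductWith⁺ _∷_ (complete (F x) d) (tuples-complete ds)

  tuples-unique : ∀ {k} (xs : Vec X k) → Unique (tuples xs)
  tuples-unique []       = [] ∷ []
  tuples-unique (x ∷ xs) =
    cartesianProductWith⁺ _∷_ ∷-inj (unique (F x)) (tuples-unique xs)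

  tuples-≟ : ∀ {k} {xs : Vec X k} → DecidableEquality (All (⌊_⌋ ∘ F) xs)
  tuples-≟ []       []         = yes refl
  tuples-≟ {xs = x ∷ _} (d ∷ ds) (d′ ∷ ds′) =
    Dec.map′ (λ (p , q) → cong₂ _∷_ p q) ∷-inj (FinSet._≟_ (F x) d d′ ×-dec tuples-≟ ds ds′)

-- The subset { x ∈ D ∣ P x }.

Subᶠ : (D : FinSet) {P : Pred ⌊ D ⌋ 0ℓ} → Decidable P → FinSet
Subᶠ D {P} P? = record
  { Carrier  = Refinement ⌊ D ⌋ P
  ; elements = select (elements D)
  ; complete = λ x → select-complete (complete D (value x)) x refl
  ; unique   = select-unique (unique D)
  ; _≟_      = λ x y → Dec.map′ value-injective (cong value) (FinSet._≟_ D (value x) (value y))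
  }
  where
  value-injective : {x y : Refinement ⌊ D ⌋ P} → value x ≡ value y → x ≡ y
  value-injective refl = refl

  select : List ⌊ D ⌋ → List (Refinement ⌊ D ⌋ P)
  select []       = []
  select (x ∷ xs) with P? x
  ... | yes p = (x Refinement., [ p ]) ∷ select xs
  ... | no  _ = select xs

  select-complete : ∀ {v xs} → v ListMem.∈ xs → (x : Refinement ⌊ D ⌋ P) → value x ≡ v →
                    x ListMem.∈ select xs
  select-complete {xs = y ∷ xs} (here refl) (_ Refinement., [ p ]) refl with P? y
  ... | yes _ = here refl
  ... | no ¬p = contradiction-irr p ¬p
    where open import Relation.Nullary.Negation.Core using (contradiction-irr)
  select-complete {xs = y ∷ xs} (there v∈) x eq with P? y
  ... | yes _ = there (select-complete v∈ x eq)
  ... | no  _ = select-complete v∈ x eq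

  select-All : ∀ {q} {Q : Pred ⌊ D ⌋ q} {xs} → ListAll.All Q xs → ListAll.All (Q ∘ value) (select xs)
  select-All []                     = []
  select-All {xs = x ∷ _} (qx ∷ qs) with P? x
  ... | yes _ = qx ∷ select-All qs
  ... | no  _ = select-All qs

  select-unique : ∀ {xs} → Unique xs → Unique (select xs)
  select-unique []                    = []
  select-unique {xs = x ∷ _} (x∉ ∷ u) with P? x
  ... | yes _ = ListAll.map (λ x≢ eq → x≢ (cong value eq)) (select-All x∉) ∷ select-unique u
  ... | no  _ = select-unique u

------------------------------------------------------------------------
-- Label cover instances

record LCConstraint (X : FinSet) (Dom : ⌊ X ⌋ → FinSet) : Set where
  field
    lhs rhs : ⌊ X ⌋
    fun     : ⌊ Dom rhs ⌋ → ⌊ Dom lhs ⌋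

record LC : Set₁ where
  field
    Var         : FinSet
    Dom         : ⌊ Var ⌋ → FinSet
    constraints : List (LCConstraint Var Dom)

record DiscreteLC : Set₁ where
  field
    Var : FinSet
    Dom : ⌊ Var ⌋ → FinSet

discrete : DiscreteLC → LC
discrete 𝓔 = record { Var = Var ; Dom = Dom ; constraints = [] }
  where open DiscreteLC 𝓔

------------------------------------------------------------------------
-- Minions

-- The sets assigned by a minion are setoids; map-cong says that the map
-- assigned to α depends on α only up to pointwise equality.

record Minion c ℓ : Set (lsuc (0ℓ ⊔ c ⊔ ℓ)) where
  field
    Obj : FinSet → Setoid c ℓ

  Elem : FinSet → Set c
  Elem D = Setoid.Carrier (Obj D)

  _≈_ : {D : FinSet} → Elem D → Elem D → Set ℓ
  _≈_ {D} = Setoid._≈_ (Obj D)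

  infix 4 _≈_

  field
    map      : ∀ {D E} → (⌊ D ⌋ → ⌊ E ⌋) → Elem D → Elem E
    map-cong : ∀ {D E} {α β : ⌊ D ⌋ → ⌊ E ⌋} {x y : Elem D} → α ≗ β →
               _≈_ {D} x y → _≈_ {E} (map {D} {E} α x) (map {D} {E} β y)
    map-id   : ∀ {D} (x : Elem D) → _≈_ {D} (map {D} {D} id x) x
    map-∘    : ∀ {D E F} (β : ⌊ E ⌋ → ⌊ F ⌋) (α : ⌊ D ⌋ → ⌊ E ⌋) (x : Elem D) →
               _≈_ {F} (map {D} {F} (β ∘ α) x) (map {E} {F} β (map {D} {E} α x))

record MinionHom (𝓜 : Minion c ℓ) (𝓝 : Minion c′ ℓ′) : Set (lsuc 0ℓ ⊔ c ⊔ ℓ ⊔ c′ ⊔ ℓ′) where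
  private
    module 𝓜 = Minion 𝓜
    module 𝓝 = Minion 𝓝
  field
    hom     : ∀ D → Func (𝓜.Obj D) (𝓝.Obj D)
    natural : ∀ {D E} (α : ⌊ D ⌋ → ⌊ E ⌋) (x : 𝓜.Elem D) →
              𝓝._≈_ {E} (Func.to (hom E) (𝓜.map {D} {E} α x)) (𝓝.map {D} {E} α (Func.to (hom D) x))

record Solution (𝓓 : LC) (𝓡 : Minion c ℓ) : Set (c ⊔ ℓ) where
  open LC 𝓓
  open Minion 𝓡
  field
    assign    : ∀ x → Elem (Dom x)
    satisfies : ListAll.All
      (λ con → let open LCConstraint con in
        _≈_ {Dom lhs} (assign lhs) (map {Dom rhs} {Dom lhs} fun (assign rhs)))
      constraints

------------------------------------------------------------------------
-- The minion describing BLP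

record Distribution (D : FinSet) : Set where
  field
    prob  : ⌊ D ⌋ → ℝ
    0≤    : ∀ a → 0ℝ ≤ℝ prob a
    ≤1    : ∀ a → prob a ≤ℝ 1ℝ
    total : ∑ (elements D) prob ≈ℝ 1ℝ
open Distribution public using (prob)

fibreSum : (D E : FinSet) → (⌊ D ⌋ → ⌊ E ⌋) → (⌊ D ⌋ → ℝ) → ⌊ E ⌋ → ℝ
fibreSum D E α f b = ∑ (filter (λ a → FinSet._≟_ E (α a) b) (elements D)) f

module ∑-lemmas where
  open import Algebra.Properties.CommutativeSemigroup
    (CommutativeMonoid.commutativeSemigroup ℝ-+-0-commutativeMonoid) using (interchange)
  import Data.List.Properties as List
  open import Relation.Binary.Reasoning.Setoid ℝ-setoid

  ∑-cong : {A : Set} (xs : List A) {f g : A → ℝ} → (∀ x → f x ≈ℝ g x) → ∑ xs f ≈ℝ ∑ xs g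
  ∑-cong []       {f} {g} f≈g = ≈ℝ.refl {0ℝ}
  ∑-cong (x ∷ xs) {f} {g} f≈g =
    ≈ℝ.∙-cong {f x} {g x} {∑ xs f} {∑ xs g} (f≈g x) (∑-cong xs f≈g)

  ∑-0 : {A : Set} (xs : List A) → ∑ xs (const 0ℝ) ≈ℝ 0ℝ
  ∑-0 []       = ≈ℝ.refl {0ℝ}
  ∑-0 (x ∷ xs) = ≈ℝ.trans {0ℝ +ℝ ∑ xs (const 0ℝ)} {∑ xs (const 0ℝ)} {0ℝ}
    (≈ℝ.identityˡ (∑ xs (const 0ℝ))) (∑-0 xs)

  ∑-+ : {A : Set} (xs : List A) (f g : A → ℝ) → ∑ xs (λ x → f x +ℝ g x) ≈ℝ ∑ xs f +ℝ ∑ xs g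
  ∑-+ []       f g = ≈ℝ.sym {0ℝ +ℝ 0ℝ} {0ℝ} (≈ℝ.identityˡ 0ℝ)
  ∑-+ (x ∷ xs) f g = begin
    (f x +ℝ g x) +ℝ ∑ xs (λ x → f x +ℝ g x)
      ≈⟨ ≈ℝ.∙-cong {f x +ℝ g x} {f x +ℝ g x} {∑ xs (λ x → f x +ℝ g x)} {∑ xs f +ℝ ∑ xs g}
           (≈ℝ.refl {f x +ℝ g x}) (∑-+ xs f g) ⟩
    (f x +ℝ g x) +ℝ (∑ xs f +ℝ ∑ xs g)
      ≈⟨ interchange (f x) (g x) (∑ xs f) (∑ xs g) ⟩
    (f x +ℝ ∑ xs f) +ℝ (g x +ℝ ∑ xs g) ∎

  ∑-nonneg : {A : Set} (xs : List A) {f : A → ℝ} → (∀ a → 0ℝ ≤ℝ f a) → 0ℝ ≤ℝ ∑ xs f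
  ∑-nonneg []       {f} 0≤f = ≈ℝ⇒≤ℝ {0ℝ} {0ℝ} (≈ℝ.refl {0ℝ})
  ∑-nonneg (x ∷ xs) {f} 0≤f =
    ≤ℝ-trans {0ℝ} {0ℝ +ℝ 0ℝ} {f x +ℝ ∑ xs f}
      (≈ℝ⇒≤ℝ {0ℝ} {0ℝ +ℝ 0ℝ} (≈ℝ.sym {0ℝ +ℝ 0ℝ} {0ℝ} (≈ℝ.identityˡ 0ℝ)))
      (+ℝ-mono-≤ℝ {0ℝ} {f x} {0ℝ} {∑ xs f} (0≤f x) (∑-nonneg xs 0≤f))

  ∑-filter-≤ : {A : Set} {P : Pred A 0ℓ} (P? : Decidable P) (xs : List A) {f : A → ℝ} →
               (∀ a → 0ℝ ≤ℝ f a) → ∑ (filter P? xs) f ≤ℝ ∑ xs f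
  ∑-filter-≤ P? []       {f} 0≤f = ≈ℝ⇒≤ℝ {0ℝ} {0ℝ} (≈ℝ.refl {0ℝ})
  ∑-filter-≤ P? (x ∷ xs) {f} 0≤f with P? x
  ... | yes _ = +ℝ-mono-≤ℝ {f x} {f x} {∑ (filter P? xs) f} {∑ xs f}
                  (≈ℝ⇒≤ℝ {f x} {f x} (≈ℝ.refl {f x})) (∑-filter-≤ P? xs 0≤f)
  ... | no  _ = ≤ℝ-trans {∑ (filter P? xs) f} {∑ xs f} {f x +ℝ ∑ xs f}
                  (∑-filter-≤ P? xs 0≤f)
                  (≤ℝ-trans {∑ xs f} {0ℝ +ℝ ∑ xs f} {f x +ℝ ∑ xs f}
                    (≈ℝ⇒≤ℝ {∑ xs f} {0ℝ +ℝ ∑ xs f}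
                      (≈ℝ.sym {0ℝ +ℝ ∑ xs f} {∑ xs f} (≈ℝ.identityˡ (∑ xs f))))
                    (+ℝ-mono-≤ℝ {0ℝ} {f x} {∑ xs f} {∑ xs f} (0≤f x)
                      (≈ℝ⇒≤ℝ {∑ xs f} {∑ xs f} (≈ℝ.refl {∑ xs f}))))

  if : {P : Set} → Dec P → ℝ → ℝ
  if (yes _) r = r
  if (no  _) r = 0ℝ

  ∑-filter-∷ : {A : Set} {P : Pred A 0ℓ} (P? : Decidable P) (x : A) (xs : List A) (f : A → ℝ) →
               ∑ (filter P? (x ∷ xs)) f ≈ℝ if (P? x) (f x) +ℝ ∑ (filter P? xs) f
  ∑-filter-∷ P? x xs f with P? x
  ... | yes _ = ≈ℝ.refl {f x +ℝ ∑ (filter P? xs) f}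
  ... | no  _ = ≈ℝ.sym {0ℝ +ℝ ∑ (filter P? xs) f} {∑ (filter P? xs) f}
                  (≈ℝ.identityˡ (∑ (filter P? xs) f))

  module _ (E : FinSet) where
    open FinSet E using (_≟_)
    open import Data.List.Membership.DecPropositional _≟_ using (_∈?_)

    ∑-≢ : ∀ e (r : ℝ) {bs} → ListAll.All (λ b → ¬ e ≡ b) bs → ∑ bs (λ b → if (e ≟ b) r) ≈ℝ 0ℝ
    ∑-≢ e r []                 = ≈ℝ.refl {0ℝ}
    ∑-≢ e r {b ∷ bs} (e≢b ∷ h) with e ≟ b
    ... | yes e≡b = contradiction e≡b e≢b
    ... | no  _   = ≈ℝ.trans {0ℝ +ℝ ∑ bs (λ b → if (e ≟ b) r)} {∑ bs (λ b → if (e ≟ b) r)} {0ℝ}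
                      (≈ℝ.identityˡ (∑ bs (λ b → if (e ≟ b) r))) (∑-≢ e r h)

    ∑-δ : ∀ e (r : ℝ) {bs} → Unique bs → ∑ bs (λ b → if (e ≟ b) r) ≈ℝ if (e ∈? bs) r
    ∑-δ e r {bs} u with e ∈? bs
    ... | no  e∉ = ∑-≢ e r (ListAll.¬Any⇒All¬ bs e∉)
    ... | yes e∈ = go u e∈
      where
      go : ∀ {bs} → Unique bs → e ListMem.∈ bs → ∑ bs (λ b → if (e ≟ b) r) ≈ℝ r
      go {b ∷ bs} (b≢ ∷ u) e∈ with e ≟ b | e∈
      ... | no e≢b   | here e≡b = contradiction e≡b e≢b
      ... | no _     | there e∈ =
        ≈ℝ.trans {0ℝ +ℝ ∑ bs (λ b → if (e ≟ b) r)} {∑ bs (λ b → if (e ≟ b) r)} {r}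
          (≈ℝ.identityˡ (∑ bs (λ b → if (e ≟ b) r))) (go u e∈)
      ... | yes refl | _ =
        ≈ℝ.trans {r +ℝ ∑ bs (λ b → if (e ≟ b) r)} {r +ℝ 0ℝ} {r}
          (≈ℝ.∙-cong {r} {r} {∑ bs (λ b → if (e ≟ b) r)} {0ℝ} (≈ℝ.refl {r}) (∑-≢ e r b≢))
          (≈ℝ.identityʳ r)

    ∑-fibres : {A : Set} (α : A → ⌊ E ⌋) (f : A → ℝ) {bs : List ⌊ E ⌋} → Unique bs →
               (as : List A) →
               ∑ bs (λ b → ∑ (filter (λ a → α a ≟ b) as) f) ≈ℝ
               ∑ (filter (λ a → α a ∈? bs) as) f
    ∑-fibres α f {bs} u []       = ∑-0 bs
    ∑-fibres α f {bs} u (a ∷ as) = begin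
      ∑ bs (λ b → ∑ (filter (λ a → α a ≟ b) (a ∷ as)) f)
        ≈⟨ ∑-cong bs {λ b → ∑ (filter (λ a → α a ≟ b) (a ∷ as)) f} {λ b → δ b +ℝ g b}
             (λ b → ∑-filter-∷ (λ a → α a ≟ b) a as f) ⟩
      ∑ bs (λ b → δ b +ℝ g b)
        ≈⟨ ∑-+ bs δ g ⟩
      ∑ bs δ +ℝ ∑ bs g
        ≈⟨ ≈ℝ.∙-cong {∑ bs δ} {if (α a ∈? bs) (f a)} {∑ bs g} {∑ (filter (λ a → α a ∈? bs) as) f}
             (∑-δ (α a) (f a) u) (∑-fibres α f u as) ⟩
      if (α a ∈? bs) (f a) +ℝ ∑ (filter (λ a → α a ∈? bs) as) f
        ≈⟨ ≈ℝ.sym {∑ (filter (λ a → α a ∈? bs) (a ∷ as)) f}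
                  {if (α a ∈? bs) (f a) +ℝ ∑ (filter (λ a → α a ∈? bs) as) f}
             (∑-filter-∷ (λ a → α a ∈? bs) a as f) ⟩
      ∑ (filter (λ a → α a ∈? bs) (a ∷ as)) f ∎
      where
      δ g : ⌊ E ⌋ → ℝ
      δ b = if (α a ≟ b) (f a)
      g b = ∑ (filter (λ a → α a ≟ b) as) f

  ≡⇒≈ℝ : ∀ {x y} → x ≡ y → x ≈ℝ y
  ≡⇒≈ℝ {x} refl = ≈ℝ.refl {x}

  fibreSum-total : ∀ D E α (f : ⌊ D ⌋ → ℝ) →
                   ∑ (elements E) (fibreSum D E α f) ≈ℝ ∑ (elements D) f
  fibreSum-total D E α f =
    ≈ℝ.trans {∑ (elements E) (fibreSum D E α f)}
             {∑ (filter (λ a → α a ∈? elements E) (elements D)) f} {∑ (elements D) f}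
      (∑-fibres E α f (unique E) (elements D))
      (≡⇒≈ℝ (cong (λ as → ∑ as f)
        (List.filter-all (λ a → α a ∈? elements E)
          (ListAll.universal (λ a → complete E (α a)) (elements D)))))
    where open import Data.List.Membership.DecPropositional (FinSet._≟_ E) using (_∈?_)

  fibreSum-cong : ∀ D E {α β : ⌊ D ⌋ → ⌊ E ⌋} {f g : ⌊ D ⌋ → ℝ} → α ≗ β →
                  (∀ a → f a ≈ℝ g a) → ∀ b → fibreSum D E α f b ≈ℝ fibreSum D E β g b
  fibreSum-cong D E {α} {β} {f} {g} α≗β f≈g b =
    ≈ℝ.trans {fibreSum D E α f b} {fibreSum D E β f b} {fibreSum D E β g b}
      (≡⇒≈ℝ (cong (λ as → ∑ as f)
        (List.filter-≐ _ _ ((λ {a} → trans (sym (α≗β a))) , (λ {a} → trans (α≗β a)))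
          (elements D))))
      (∑-cong (filter (λ a → FinSet._≟_ E (β a) b) (elements D)) f≈g)

  fibreSum-id : ∀ D (f : ⌊ D ⌋ → ℝ) b → fibreSum D D id f b ≈ℝ f b
  fibreSum-id D f b = begin
    ∑ (filter (_≟ b) (elements D)) f
      ≈⟨ ∑-filter (elements D) ⟩
    ∑ (elements D) (λ a → if (b ≟ a) (f b))
      ≈⟨ ∑-δ D b (f b) (unique D) ⟩
    if (b ∈? elements D) (f b)
      ≈⟨ if-yes (b ∈? elements D) (complete D b) ⟩
    f b ∎
    where
    open FinSet D using (_≟_)
    open import Data.List.Membership.DecPropositional _≟_ using (_∈?_)

    if-yes : {P : Set} (d : Dec P) → P → if d (f b) ≈ℝ f b
    if-yes (yes _) p = ≈ℝ.refl {f b}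
    if-yes (no ¬p) p = contradiction p ¬p

    if-swap : ∀ a → if (a ≟ b) (f a) ≈ℝ if (b ≟ a) (f b)
    if-swap a with a ≟ b | b ≟ a
    ... | yes refl | yes _  = ≈ℝ.refl {f a}
    ... | yes refl | no ¬p  = contradiction refl ¬p
    ... | no ¬p    | yes p  = contradiction (sym p) ¬p
    ... | no _     | no _   = ≈ℝ.refl {0ℝ}

    ∑-filter : ∀ as → ∑ (filter (_≟ b) as) f ≈ℝ ∑ as (λ a → if (b ≟ a) (f b))
    ∑-filter []       = ≈ℝ.refl {0ℝ}
    ∑-filter (a ∷ as) =
      ≈ℝ.trans {∑ (filter (_≟ b) (a ∷ as)) f} {if (a ≟ b) (f a) +ℝ ∑ (filter (_≟ b) as) f}
               {if (b ≟ a) (f b) +ℝ ∑ as (λ a → if (b ≟ a) (f b))}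
        (∑-filter-∷ (_≟ b) a as f)
        (≈ℝ.∙-cong {if (a ≟ b) (f a)} {if (b ≟ a) (f b)}
                   {∑ (filter (_≟ b) as) f} {∑ as (λ a → if (b ≟ a) (f b))}
          (if-swap a) (∑-filter as))

  fibreSum-∘ : ∀ D E F (β : ⌊ E ⌋ → ⌊ F ⌋) (α : ⌊ D ⌋ → ⌊ E ⌋) (f : ⌊ D ⌋ → ℝ) c →
               fibreSum D F (β ∘ α) f c ≈ℝ fibreSum E F β (fibreSum D E α f) c
  fibreSum-∘ D E F β α f c =
    ≈ℝ.sym {fibreSum E F β (fibreSum D E α f) c} {fibreSum D F (β ∘ α) f c}
      (≈ℝ.trans {fibreSum E F β (fibreSum D E α f) c}
                {∑ (filter (λ a → α a ∈? fibre) (elements D)) f} {fibreSum D F (β ∘ α) f c}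
        (∑-fibres E α f (filter⁺ (λ b → FinSet._≟_ F (β b) c) (unique E)) (elements D))
        (≡⇒≈ℝ (cong (λ as → ∑ as f)
          (List.filter-≐ (λ a → α a ∈? fibre) (λ a → FinSet._≟_ F (β (α a)) c)
            ( (λ {a} a∈ → proj₂ (∈-filter⁻ (λ b → FinSet._≟_ F (β b) c) {xs = elements E} a∈))
            , (λ {a} eq → ∈-filter⁺ (λ b → FinSet._≟_ F (β b) c) (complete E (α a)) eq))
            (elements D)))))
    where
    open import Data.List.Membership.DecPropositional (FinSet._≟_ E) using (_∈?_)
    open import Data.List.Membership.Propositional.Properties using (∈-filter⁺; ∈-filter⁻)
    open import Data.List.Relation.Unary.Unique.Propositional.Properties using (filter⁺)
    fibre : List ⌊ E ⌋
    fibre = filter (λ b → FinSet._≟_ F (β b) c) (elements E)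

open ∑-lemmas

BLP : Minion 0ℓ 0ℓ
BLP = record
  { Obj = λ D → record
      { Carrier = Distribution D
      ; _≈_     = λ f g → ∀ a → prob f a ≈ℝ prob g a
      ; isEquivalence = record
        { refl  = λ {f} a → ≈ℝ.refl {prob f a}
        ; sym   = λ {f} {g} eq a → ≈ℝ.sym {prob f a} {prob g a} (eq a)
        ; trans = λ {f} {g} {h} eq eq′ a → ≈ℝ.trans {prob f a} {prob g a} {prob h a} (eq a) (eq′ a)
        }
      }
  ; map      = λ {D} {E} → pushforward D E
  ; map-cong = λ {D} {E} {α} {β} {f} {g} α≗β f≈g → fibreSum-cong D E {f = prob f} {prob g} α≗β f≈g
  ; map-id   = λ {D} f → fibreSum-id D (prob f)
  ; map-∘    = λ {D} {E} {F} β α f → fibreSum-∘ D E F β α (prob f)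
  }
  where
  pushforward : ∀ D E → (⌊ D ⌋ → ⌊ E ⌋) → Distribution D → Distribution E
  pushforward D E α f = record
    { prob  = fibreSum D E α (prob f)
    ; 0≤    = λ b → ∑-nonneg (filter (λ a → FinSet._≟_ E (α a) b) (elements D)) 0≤
    ; ≤1    = λ b →
        ≤ℝ-trans {fibreSum D E α (prob f) b} {∑ (elements D) (prob f)} {1ℝ}
          (∑-filter-≤ (λ a → FinSet._≟_ E (α a) b) (elements D) 0≤)
          (≈ℝ⇒≤ℝ {∑ (elements D) (prob f)} {1ℝ} total)
    ; total =
        ≈ℝ.trans {∑ (elements E) (fibreSum D E α (prob f))} {∑ (elements D) (prob f)} {1ℝ}
          (fibreSum-total D E α (prob f)) total
    }
    where open Distribution f using (0≤; ≤1; total)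

------------------------------------------------------------------------
-- Saturated powers

module _ (𝓓 : LC) where
  open LC 𝓓
  open LCConstraint

  private
    Con = LCConstraint Var Dom

  reflexiveClosure : List Con
  reflexiveClosure =
    List.map (λ x → record { lhs = x ; rhs = x ; fun = id }) (elements Var) ++ constraints

  productFun : ∀ {k} (cs : Vec Con k) →
               All (⌊_⌋ ∘ Dom) (Vec.map rhs cs) → All (⌊_⌋ ∘ Dom) (Vec.map lhs cs)
  productFun []       []       = []
  productFun (α ∷ cs) (d ∷ ds) = fun α d ∷ productFun cs ds

  -- A function σ from [k] to [j] is represented by its vector of values.
  reindex : ∀ {j k} (σ : Vec (Fin j) k) {xs : Vec ⌊ Var ⌋ j} →
            All (⌊_⌋ ∘ Dom) xs → All (⌊_⌋ ∘ Dom) (Vec.map (lookup xs) σ)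
  reindex []      ds = []
  reindex (i ∷ σ) ds = lookup⁺ ds i ∷ reindex σ ds
    where open import Data.Vec.Relation.Unary.All.Properties using (lookup⁺)

  pow : ℕ → LC
  pow k = record
    { Var         = Var ^ᶠ k
    ; Dom         = Πᶠ Dom
    ; constraints =
        List.map (λ cs → record { lhs = Vec.map lhs cs ; rhs = Vec.map rhs cs ; fun = productFun cs })
          (vectors reflexiveClosure k)
        ++
        cartesianProductWith
          (λ xs σ → record { lhs = Vec.map (lookup xs) σ ; rhs = xs ; fun = reindex σ })
          (elements (Var ^ᶠ k)) (elements (Finᶠ k ^ᶠ k))
    }

------------------------------------------------------------------------
-- Levels of a minion

-- The level lvlₖ 𝓡 for k = suc j.

module _ (j : ℕ) (𝓡 : Minion c ℓ) where
  private
    module 𝓡 = Minion 𝓡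

  module _ (𝓔 : DiscreteLC) where
    open DiscreteLC 𝓔

    Frame : FinSet → Vec ⌊ Var ⌋ j → FinSet
    Frame C ys = C ×ᶠ Πᶠ Dom ys

    first : ∀ {C C′ ys} → (⌊ C ⌋ → ⌊ C′ ⌋) → ⌊ Frame C ys ⌋ → ⌊ Frame C′ ys ⌋
    first α (c , ds) = α c , ds

    firstOf : ∀ {C z ys} → (⌊ Dom z ⌋ → ⌊ C ⌋) → ⌊ Πᶠ Dom (z ∷ ys) ⌋ → ⌊ Frame C ys ⌋
    firstOf β (d ∷ ds) = β d , ds

    record LevelElem (C : FinSet) : Set (c ⊔ ℓ) where
      field
        r : Solution (pow (discrete 𝓔) (suc j)) 𝓡
        ω : ∀ ys → 𝓡.Elem (Frame C ys)
        generated : Σ[ z ∈ ⌊ Var ⌋ ] Σ[ β ∈ (⌊ Dom z ⌋ → ⌊ C ⌋) ] ∀ ys →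
          𝓡._≈_ {Frame C ys} (ω ys)
            (𝓡.map {Πᶠ Dom (z ∷ ys)} {Frame C ys} (firstOf {C} β) (Solution.assign r (z ∷ ys)))

    -- Equality of triples compares r and ω only; the choice of z and β is
    -- not part of the data.
    record _≋_ {C : FinSet} (u v : LevelElem C) : Set (c ⊔ ℓ) where
      private
        module u = LevelElem u
        module v = LevelElem v
      field
        r≈ : ∀ ys → 𝓡._≈_ {Πᶠ Dom ys} (Solution.assign u.r ys) (Solution.assign v.r ys)
        ω≈ : ∀ ys → 𝓡._≈_ {Frame C ys} (u.ω ys) (v.ω ys)

    mapLevel : ∀ {C C′} → (⌊ C ⌋ → ⌊ C′ ⌋) → LevelElem C → LevelElem C′
    mapLevel {C} {C′} α u = record
      { r = r
      ; ω = λ ys → 𝓡.map {Frame C ys} {Frame C′ ys} (first {C} {C′} α) (ω ys)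
      ; generated =
          let z , β , eq = generated
          in z , α ∘ β , λ ys →
            let module S = Setoid (𝓡.Obj (Frame C′ ys)) in
            S.trans
              (𝓡.map-cong {Frame C ys} {Frame C′ ys} (λ _ → refl) (eq ys))
              (S.trans
                (S.sym (𝓡.map-∘ {Πᶠ Dom (z ∷ ys)} {Frame C ys} {Frame C′ ys}
                  (first {C} {C′} α) (firstOf {C} β) (Solution.assign r (z ∷ ys))))
                (𝓡.map-cong {Πᶠ Dom (z ∷ ys)} {Frame C′ ys} (λ { (d ∷ ds) → refl })
                  (Setoid.refl (𝓡.Obj (Πᶠ Dom (z ∷ ys))))))
      }
      where open LevelElem u

  -- Two triples (𝓔 , r , ω) can only be equal over one and the same 𝓔.
  data LevelEq {C : FinSet} :
       (u v : Σ DiscreteLC λ 𝓔 → LevelElem 𝓔 C) → Set (lsuc 0ℓ ⊔ c ⊔ ℓ) where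
    over : ∀ {𝓔} {u v : LevelElem 𝓔 C} → _≋_ 𝓔 u v → LevelEq (𝓔 , u) (𝓔 , v)

  level : Minion (lsuc 0ℓ ⊔ c ⊔ ℓ) (lsuc 0ℓ ⊔ c ⊔ ℓ)
  level = record
    { Obj = λ C → record
        { Carrier = Σ DiscreteLC λ 𝓔 → LevelElem 𝓔 C
        ; _≈_     = LevelEq
        ; isEquivalence = record
          { refl  = λ { {𝓔 , u} → over record
              { r≈ = λ ys → Setoid.refl (𝓡.Obj (Πᶠ (DiscreteLC.Dom 𝓔) ys))
              ; ω≈ = λ ys → Setoid.refl (𝓡.Obj (Frame 𝓔 C ys)) } }
          ; sym   = λ { (over {𝓔} e) → over record
              { r≈ = λ ys → Setoid.sym (𝓡.Obj (Πᶠ (DiscreteLC.Dom 𝓔) ys)) (_≋_.r≈ e ys)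
              ; ω≈ = λ ys → Setoid.sym (𝓡.Obj (Frame 𝓔 C ys)) (_≋_.ω≈ e ys) } }
          ; trans = λ { (over {𝓔} e) (over e′) → over record
              { r≈ = λ ys → Setoid.trans (𝓡.Obj (Πᶠ (DiscreteLC.Dom 𝓔) ys)) (_≋_.r≈ e ys) (_≋_.r≈ e′ ys)
              ; ω≈ = λ ys → Setoid.trans (𝓡.Obj (Frame 𝓔 C ys)) (_≋_.ω≈ e ys) (_≋_.ω≈ e′ ys) } }
          }
        }
    ; map      = λ α (𝓔 , u) → 𝓔 , mapLevel 𝓔 α u
    ; map-cong = λ { {C} {C′} {α} {β} α≗β (over {𝓔} e) → over record
        { r≈ = _≋_.r≈ e
        ; ω≈ = λ ys → 𝓡.map-cong {Frame 𝓔 C ys} {Frame 𝓔 C′ ys}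
                 (λ (c , _) → cong (_, _) (α≗β c)) (_≋_.ω≈ e ys) } }
    ; map-id   = λ { {C} (𝓔 , u) → over record
        { r≈ = λ ys → Setoid.refl (𝓡.Obj (Πᶠ (DiscreteLC.Dom 𝓔) ys))
        ; ω≈ = λ ys → 𝓡.map-id {Frame 𝓔 C ys} (LevelElem.ω u ys) } }
    ; map-∘    = λ { {C} {C′} {C″} β α (𝓔 , u) → over record
        { r≈ = λ ys → Setoid.refl (𝓡.Obj (Πᶠ (DiscreteLC.Dom 𝓔) ys))
        ; ω≈ = λ ys → 𝓡.map-∘ {Frame 𝓔 C ys} {Frame 𝓔 C′ ys} {Frame 𝓔 C″ ys}
                 (first 𝓔 {C′} {C″} β) (first 𝓔 {C} {C′} α) (LevelElem.ω u ys) } }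
    }

lvl : (k : ℕ) .{{_ : NonZero k}} → Minion c ℓ → Minion (lsuc 0ℓ ⊔ c ⊔ ℓ) (lsuc 0ℓ ⊔ c ⊔ ℓ)
lvl (suc j) = level j

------------------------------------------------------------------------
-- Structures and PCSP templates

record Signature : Set₁ where
  field
    Symbol : FinSet
    ar     : ⌊ Symbol ⌋ → ℕ
    ar≥1   : ∀ R → 1 ℕ.≤ ar R

record Structure (𝓢 : Signature) : Set₁ where
  open Signature 𝓢
  field
    universe : FinSet
    nonempty : ⌊ universe ⌋
    Rel      : ∀ R → Pred (Vec ⌊ universe ⌋ (ar R)) 0ℓ
    Rel?     : ∀ R → Decidable (Rel R)

record StructureHom {𝓢 : Signature} (𝔸 𝔹 : Structure 𝓢) : Set where
  private
    module 𝔸 = Structure 𝔸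
    module 𝔹 = Structure 𝔹
  field
    fun       : ⌊ 𝔸.universe ⌋ → ⌊ 𝔹.universe ⌋
    preserves : ∀ R {t} → 𝔸.Rel R t → 𝔹.Rel R (Vec.map fun t)

record PCSPTemplate : Set₁ where
  field
    {𝓢}    : Signature
    𝔸 𝔹    : Structure 𝓢
    𝔸→𝔹    : StructureHom 𝔸 𝔹

module _ {𝓢 : Signature} (𝔸 𝔹 : Structure 𝓢) where
  private
    module 𝔸 = Structure 𝔸
    module 𝔹 = Structure 𝔹

  -- A tuple over 𝔸^D is related iff it is so in every coordinate d.
  record Polymorphism (D : FinSet) : Set where
    field
      fun       : (⌊ D ⌋ → ⌊ 𝔸.universe ⌋) → ⌊ 𝔹.universe ⌋
      fun-cong  : ∀ {a a′} → a ≗ a′ → fun a ≡ fun a′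
      preserves : ∀ R (t : Vec (⌊ D ⌋ → ⌊ 𝔸.universe ⌋) _) →
                  (∀ d → 𝔸.Rel R (Vec.map (λ a → a d) t)) → 𝔹.Rel R (Vec.map fun t)

  Pol : Minion 0ℓ 0ℓ
  Pol = record
    { Obj = λ D → record
        { Carrier = Polymorphism D
        ; _≈_     = λ f g → fun f ≗ fun g
        ; isEquivalence = record
          { refl  = λ _ → refl
          ; sym   = λ e a → sym (e a)
          ; trans = λ e e′ a → trans (e a) (e′ a)
          }
        }
    ; map      = λ {D} {E} α f → record
        { fun       = λ a → fun f (a ∘ α)
        ; fun-cong  = λ a≗a′ → fun-cong f (a≗a′ ∘ α)
        ; preserves = λ R t h →
            subst (𝔹.Rel R) (sym (Vec.map-∘ (fun f) (_∘ α) t))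
              (preserves f R (Vec.map (_∘ α) t)
                (λ d → subst (𝔸.Rel R) (Vec.map-∘ (λ a → a d) (_∘ α) t) (h (α d))))
        }
    ; map-cong = λ {_} {_} {_} {_} {f} α≗β f≗g a → trans (fun-cong f (cong a ∘ α≗β)) (f≗g _)
    ; map-id   = λ _ _ → refl
    ; map-∘    = λ _ _ _ _ → refl
    }
    where open Polymorphism

------------------------------------------------------------------------
-- Instances and the Sherali–Adams hierarchy

-- Variable names are drawn from Fin n; the variables of an instance are
-- those that occur in its constraints.

record Instance (𝓢 : Signature) : Set where
  open Signature 𝓢
  field
    n           : ℕ
    constraints : List (Σ[ R ∈ ⌊ Symbol ⌋ ] Vec (Fin n) (ar R))

  variables : Subset n
  variables = ⋃ (List.map (λ (R , xs) → ⋃ (List.map ⁅_⁆ (Vec.toList xs))) constraints)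

InstanceSolution : {𝓢 : Signature} → Instance 𝓢 → Structure 𝓢 → Set
InstanceSolution 𝓘 𝔹 =
  Σ[ s ∈ (Fin n → ⌊ universe ⌋) ]
    ListAll.All (λ (R , xs) → Rel R (Vec.map s xs)) constraints
  where
  open Instance 𝓘
  open Structure 𝔹

-- A function U → A is a vector indexed by all of Fin n that has a value
-- in A at the positions belonging to U and a dummy value elsewhere.

module _ (A : FinSet) where

  Value : Side → FinSet
  Value inside  = A
  Value outside = ⊤ᶠ

  PartialMap : ∀ {n} → Subset n → FinSet
  PartialMap = Πᶠ Value

  apply : ∀ {n} {U : Subset n} → ⌊ PartialMap U ⌋ → ∀ {x} → x ∈ U → ⌊ A ⌋
  apply (a ∷ f) here      = a
  apply (a ∷ f) (there x) = apply f x

  applyAll : ∀ {n} {U : Subset n} → ⌊ PartialMap U ⌋ →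
             ∀ {k} {xs : Vec (Fin n) k} → All (_∈ U) xs → Vec ⌊ A ⌋ k
  applyAll f = All.reduce (apply f)

  restrict : ∀ {n} {U U′ : Subset n} → U ⊆ U′ → ⌊ PartialMap U′ ⌋ → ⌊ PartialMap U ⌋
  restrict {U = []}          U⊆U′ []      = []
  restrict {U = inside  ∷ U} U⊆U′ f@(_ ∷ f′) = apply f (U⊆U′ here) ∷ restrict (drop-∷-⊆ U⊆U′) f′
  restrict {U = outside ∷ U} U⊆U′ (_ ∷ f) = tt ∷ restrict (drop-∷-⊆ U⊆U′) f

  apply-restrict : ∀ {n} {U U′ : Subset n} (U⊆U′ : U ⊆ U′) (f : ⌊ PartialMap U′ ⌋) {x} (x∈U : x ∈ U) →
                   apply (restrict U⊆U′ f) x∈U ≡ apply f (U⊆U′ x∈U)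
  apply-restrict {U = inside ∷ U}  U⊆U′ (_ ∷ f) here = refl
  apply-restrict {U = inside ∷ U}  U⊆U′ (a ∷ f) (there x∈U) with U⊆U′ (there x∈U)
  ... | there p = trans (apply-restrict _ f x∈U) (cong (apply f) ([]=-irrelevant _ _))
  apply-restrict {U = outside ∷ U} U⊆U′ (a ∷ f) (there x∈U) with U⊆U′ (there x∈U)
  ... | there p = trans (apply-restrict _ f x∈U) (cong (apply f) ([]=-irrelevant _ _))

  applyAll-restrict : ∀ {n} {U U′ : Subset n} (U⊆U′ : U ⊆ U′) (f : ⌊ PartialMap U′ ⌋)
                      {k} {xs : Vec (Fin n) k} (xs⊆U : All (_∈ U) xs) →
                      applyAll (restrict U⊆U′ f) xs⊆U ≡ applyAll f (All.map U⊆U′ xs⊆U)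
  applyAll-restrict U⊆U′ f []           = refl
  applyAll-restrict U⊆U′ f (x∈U ∷ xs⊆U) =
    cong₂ _∷_ (apply-restrict U⊆U′ f x∈U) (applyAll-restrict U⊆U′ f xs⊆U)

module _ {𝓢 : Signature} (𝔸 : Structure 𝓢) (𝓘 : Instance 𝓢) where
  open Structure 𝔸
  open Instance 𝓘

  IsPartialSolution : (U : Subset n) → Pred ⌊ PartialMap universe U ⌋ 0ℓ
  IsPartialSolution U f =
    ListAll.All (λ (R , xs) → (xs⊆U : All (_∈ U) xs) → Rel R (applyAll universe f xs⊆U)) constraints

  isPartialSolution? : ∀ U → Decidable (IsPartialSolution U)
  isPartialSolution? U f = ListAll.all? (λ (R , xs) → holds? R xs) constraints
    where
    holds? : ∀ R xs → Dec ((xs⊆U : All (_∈ U) xs) → Rel R (applyAll universe f xs⊆U))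
    holds? R xs with All.all? (Subset._∈? U) xs
    ... | no  xs⊈U = yes (λ xs⊆U → contradiction xs⊆U xs⊈U)
    ... | yes xs⊆U = Dec.map′
      (λ h xs⊆U′ → subst (Rel R ∘ applyAll universe f) (All.irrelevant []=-irrelevant xs⊆U xs⊆U′) h)
      (λ h → h xs⊆U)
      (Rel? R (applyAll universe f xs⊆U))

  PartialSolution : Subset n → FinSet
  PartialSolution U = Subᶠ (PartialMap universe U) (isPartialSolution? U)

  res : ∀ {U U′} → U ⊆ U′ → ⌊ PartialSolution U′ ⌋ → ⌊ PartialSolution U ⌋
  res U⊆U′ = Refinement.map (restrict universe U⊆U′)
    (λ {f} → ListAll.map λ {(R , xs)} h xs⊆U →
      subst (Rel R) (sym (applyAll-restrict universe U⊆U′ f xs⊆U)) (h (All.map U⊆U′ xs⊆U)))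

  smallSets : ℕ → FinSet
  smallSets m = Subᶠ (Sideᶠ ^ᶠ n) (λ U → (U ⊆? variables) ×-dec (∣ U ∣ ℕ.≤? m))

  lc : ℕ → LC
  lc m = record
    { Var         = smallSets m
    ; Dom         = PartialSolution ∘ value
    ; constraints = concatMap inclusion (cartesianProduct (elements (smallSets m)) (elements (smallSets m)))
    }
    where
    inclusion : ⌊ smallSets m ⌋ × ⌊ smallSets m ⌋ →
                List (LCConstraint (smallSets m) (PartialSolution ∘ value))
    inclusion (U , U′) with value U ⊆? value U′
    ... | yes U⊆U′ = record { lhs = U ; rhs = U′ ; fun = res U⊆U′ } ∷ []
    ... | no  _    = []

SolvedBySheraliAdams : PCSPTemplate → ℕ → Set
SolvedBySheraliAdams 𝓣 m =
  (𝓘 : Instance 𝓢) → Solution (lc 𝔸 𝓘 m) BLP → InstanceSolution 𝓘 𝔹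
  where open PCSPTemplate 𝓣

{-# OPTIONS --safe #-}
module Submission where

-- From a homomorphism lvlₖ BLP → Pol(𝔸, 𝔹) to solutions in 𝔹: let M exceed all
-- arities and take a Sherali–Adams solution of level k M.  The sets of at most
-- M variables, with their partial solutions as domains, form a discrete
-- instance 𝓔, and restricting the given solution at U₁ ∪ … ∪ Uₖ to the Uᵢ is a
-- solution r of powₖ 𝓔.  A variable x yields the element of the level
-- generated by {x} and f ↦ f(x); its image is a polymorphism 𝔸^A → 𝔹, and x is
-- sent to the value of that polymorphism at the identity.  A constraint
-- x₁ … xₙ ∈ R holds because all these elements are images of the single one
-- generated by {x₁, …, xₙ} and f ↦ f(x₁) … f(xₙ) ∈ R.
--
-- Conversely, let level m of Sherali–Adams solve PCSP(𝔸, 𝔹), and let k exceed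
-- m plus all arities.  For 𝓔 and a solution r of powₖ 𝓔, the pairs (z, g) with
-- g : 𝓔_z → A, identified when they generate the same element of the level,
-- are the variables of an instance with a constraint (z, g₁) … (z, gₙ) ∈ R
-- whenever g₁(d) … gₙ(d) ∈ R for all d.  Pushing r forward along the maps g
-- gives a Sherali–Adams solution, independent of the choice of names for the
-- variables.  A solution in 𝔹 sends each (z, g) to a value; for fixed z this is
-- a polymorphism 𝔸^{𝓔_z} → 𝔹, and these polymorphisms define the homomorphism.

open import Defs
open import Axiom.ExcludedMiddle using (ExcludedMiddle)
open import Data.Nat.Base using (ℕ; suc; NonZero; _≤_)
open import Data.Product.Base using (∃-syntax; Σ-syntax; _×_)
open import Function.Bundles using (_⇔_)
open import Level using (0ℓ)

open ∑-lemmas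
open import Data.Fin.Base using (Fin; zero; suc; toℕ; fromℕ<; inject≤)
import Data.Fin.Properties as Fin
open import Data.Fin.Subset using (Subset; inside; outside; _∈_; _⊆_; ∣_∣; ⁅_⁆; ⋃; _∪_; ⊥)
open import Data.Fin.Subset.Properties using (_∈?_)
import Data.Fin.Subset.Properties as Subset
open import Data.Irrelevant as Irrelevant using ([_])
open import Data.List.Base as List using (List; []; _∷_; filter; concatMap; allFin)
open import Data.List.Extrema.Nat using (max; xs≤max)
open import Data.List.Membership.Propositional using (find) renaming (_∈_ to _∈ˡ_)
open import Data.List.Membership.Propositional.Properties
  using (∈-cartesianProduct⁺; ∈-cartesianProductWith⁺; ∈-cartesianProductWith⁻; ∈-map⁺; ∈-map⁻;
         ∈-++⁻; ∈-concat⁻′; ∈-concatMap⁺; ∈-filter⁺; ∈-filter⁻; ∈-allFin)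
import Data.List.Properties as List
import Data.List.Relation.Unary.All as ListAll
import Data.List.Relation.Unary.All.Properties as ListAll
open import Data.List.Relation.Unary.Any as Any using (here; there)
open import Data.List.Relation.Unary.Any.Properties using (lookup-index)
open import Data.Nat.Base using (zero; _+_; _*_; _<_; _⊔_; z≤n; s≤s)
import Data.Nat.Properties as ℕ
open import Data.Product.Base using (Σ; _,_; proj₁; proj₂)
import Data.Rational.Base as ℚ
import Data.Rational.Properties as ℚ
open import Data.Rational.Solver using (module +-*-Solver)
open import Data.Refinement.Base using (Refinement; value; proof; _,_)
open import Data.Sum.Base using (_⊎_; inj₁; inj₂; [_,_]′)
open import Data.Unit.Base using (tt)
open import Data.Vec.Base as Vec
  using (Vec; []; _∷_; lookup; tabulate; replicate; head; here; there; _[_]≔_)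
import Data.Vec.Properties as Vec
open import Data.Vec.Properties.WithK using ([]=-irrelevant)
open import Data.Vec.Relation.Unary.All as All using (All; []; _∷_)
open import Data.Vec.Relation.Unary.All.Properties using (lookup⁺)
open import Function.Base using (id; _∘_; const; _$_)
open import Function.Bundles using (Func; mk⇔)
open import Function.Definitions using (Injective)
open import Relation.Binary.Bundles using (Setoid)
open import Relation.Binary.PropositionalEquality
  using (_≡_; _≗_; refl; sym; trans; cong; cong₂; cong-app; subst; subst₂)
open import Relation.Nullary using (¬_; Dec; yes; no; contradiction; recompute)
open import Relation.Nullary.Negation.Core using (contradiction-irr)
open import Relation.Unary using (Decidable)

-- Partial maps, sizes of unions, and vectors over a list

apply-ext : ∀ {A n} {U : Subset n} (f g : ⌊ PartialMap A U ⌋) →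
            (∀ {x} (x∈U : x ∈ U) → apply A f x∈U ≡ apply A g x∈U) → f ≡ g
apply-ext {U = []}          []       []       eq = refl
apply-ext {U = inside ∷ U}  (a ∷ f)  (b ∷ g)  eq = cong₂ _∷_ (eq here) (apply-ext f g (eq ∘ there))
apply-ext {U = outside ∷ U} (tt ∷ f) (tt ∷ g) eq = cong (tt ∷_) (apply-ext f g (eq ∘ there))

∣p∪q∣≤∣p∣+∣q∣ : ∀ {n} (p q : Subset n) → ∣ p ∪ q ∣ ≤ ∣ p ∣ + ∣ q ∣
∣p∪q∣≤∣p∣+∣q∣ []            []            = z≤n
∣p∪q∣≤∣p∣+∣q∣ (outside ∷ p) (outside ∷ q) = ∣p∪q∣≤∣p∣+∣q∣ p q
∣p∪q∣≤∣p∣+∣q∣ (outside ∷ p) (inside ∷ q)  =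
  ℕ.≤-trans (s≤s (∣p∪q∣≤∣p∣+∣q∣ p q)) (ℕ.≤-reflexive (sym (ℕ.+-suc ∣ p ∣ ∣ q ∣)))
∣p∪q∣≤∣p∣+∣q∣ (inside ∷ p)  (outside ∷ q) = s≤s (∣p∪q∣≤∣p∣+∣q∣ p q)
∣p∪q∣≤∣p∣+∣q∣ (inside ∷ p)  (inside ∷ q)  =
  s≤s (ℕ.≤-trans (∣p∪q∣≤∣p∣+∣q∣ p q) (ℕ.+-monoʳ-≤ ∣ p ∣ (ℕ.n≤1+n ∣ q ∣)))

∪-lub : ∀ {n} {p q r : Subset n} → p ⊆ r → q ⊆ r → p ∪ q ⊆ r
∪-lub {p = p} {q} p⊆r q⊆r x∈ = [ p⊆r , q⊆r ]′ (Subset.x∈p∪q⁻ p q x∈)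

value-injective : ∀ {A : Set} {P : A → Set} {x y : Refinement A P} → value x ≡ value y → x ≡ y
value-injective refl = refl

∈-vectors⁻ : ∀ {A : Set} (xs : List A) {k} {v : Vec A k} → v ∈ˡ vectors xs k → All (_∈ˡ xs) v
∈-vectors⁻ xs {zero}  {[]} _  = []
∈-vectors⁻ xs {suc k} v∈ with ∈-cartesianProductWith⁻ _∷_ xs (vectors xs k) v∈
... | _ , _ , x∈ , w∈ , refl = x∈ ∷ ∈-vectors⁻ xs w∈

-- Restriction maps and solutions of Sherali-Adams instances

module _ {𝓢 : Signature} (𝔸 : Structure 𝓢) (𝓘 : Instance 𝓢) where
  open Structure 𝔸 using () renaming (universe to A)
  open Instance 𝓘

  res-value : ∀ {U V W : Subset n} {U⊆V : U ⊆ V} {V⊆W : V ⊆ W} {U⊆W : U ⊆ W}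
              (f : ⌊ PartialMap A W ⌋) →
              restrict A U⊆V (restrict A V⊆W f) ≡ restrict A U⊆W f
  res-value {U⊆V = U⊆V} {V⊆W} {U⊆W} f = apply-ext _ _ λ x∈U →
    trans (apply-restrict A U⊆V (restrict A V⊆W f) x∈U)
      (trans (apply-restrict A V⊆W f (U⊆V x∈U))
        (trans (cong (apply A f) ([]=-irrelevant _ _))
          (sym (apply-restrict A U⊆W f x∈U))))

  res-∘ : ∀ {U V W : Subset n} (U⊆V : U ⊆ V) (V⊆W : V ⊆ W) (U⊆W : U ⊆ W) f →
          res 𝔸 𝓘 U⊆V (res 𝔸 𝓘 V⊆W f) ≡ res 𝔸 𝓘 U⊆W f
  res-∘ U⊆V V⊆W U⊆W f = value-injective (res-value {U⊆V = U⊆V} {V⊆W} {U⊆W} (value f))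

  res-irrelevant : ∀ {U W : Subset n} (p q : U ⊆ W) f → res 𝔸 𝓘 p f ≡ res 𝔸 𝓘 q f
  res-irrelevant p q f = value-injective (apply-ext _ _ λ x∈U →
    trans (apply-restrict A p (value f) x∈U)
      (trans (cong (apply A (value f)) ([]=-irrelevant _ _))
        (sym (apply-restrict A q (value f) x∈U))))

  module _ {c ℓ} (𝓡 : Minion c ℓ) {m : ℕ} (s : Solution (lc 𝔸 𝓘 m) 𝓡) where
    open Minion 𝓡
    open Solution s

    -- The constraints of `lc` run over all pairs of small sets and carry the inclusion proof found
    -- by the decision procedure; `res-irrelevant` exchanges it for the given one.
    assign-res : ∀ U W (U⊆W : value U ⊆ value W) →
                 _≈_ {PartialSolution 𝔸 𝓘 (value U)} (assign U)
                   (map {PartialSolution 𝔸 𝓘 (value W)} {PartialSolution 𝔸 𝓘 (value U)}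
                     (res 𝔸 𝓘 U⊆W) (assign W))
    assign-res U W U⊆W
      with value U Subset.⊆? value W
         | ListAll.lookup (ListAll.map⁻ (ListAll.concat⁻ satisfies))
             (∈-cartesianProduct⁺ (complete (smallSets 𝔸 𝓘 m) U) (complete (smallSets 𝔸 𝓘 m) W))
    ... | no ¬U⊆W  | _ = contradiction (λ {x} → U⊆W {x}) ¬U⊆W
    ... | yes U⊆W′ | eq ListAll.∷ _ =
      Setoid.trans (Obj _) eq
        (map-cong {PartialSolution 𝔸 𝓘 (value W)} {PartialSolution 𝔸 𝓘 (value U)}
          (res-irrelevant U⊆W′ U⊆W) (Setoid.refl (Obj _)))

  module _ {c ℓ} (𝓡 : Minion c ℓ) {m : ℕ} where
    open Minion 𝓡

    lcSolution : (local : ∀ U → Elem (PartialSolution 𝔸 𝓘 (value U))) →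
      (∀ U W (U⊆W : value U ⊆ value W) →
        _≈_ {PartialSolution 𝔸 𝓘 (value U)} (local U)
          (map {PartialSolution 𝔸 𝓘 (value W)} {PartialSolution 𝔸 𝓘 (value U)} (res 𝔸 𝓘 U⊆W) (local W))) →
      Solution (lc 𝔸 𝓘 m) 𝓡
    lcSolution local local-res = record { assign = local ; satisfies = ListAll.tabulate satisfied }
      where
      pairs : FinSet
      pairs = smallSets 𝔸 𝓘 m ×ᶠ smallSets 𝔸 𝓘 m

      satisfied : ∀ {con} → con ∈ˡ LC.constraints (lc 𝔸 𝓘 m) → let open LCConstraint con in
        _≈_ {PartialSolution 𝔸 𝓘 (value lhs)} (local lhs)
          (map {PartialSolution 𝔸 𝓘 (value rhs)} {PartialSolution 𝔸 𝓘 (value lhs)} fun (local rhs))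
      satisfied con∈ with ∈-concat⁻′ _ con∈
      ... | _ , con∈′ , cons∈ with ∈-map⁻ {A = ⌊ pairs ⌋} _ {xs = elements pairs} cons∈
      ...   | (U , W) , _ , refl with value U Subset.⊆? value W | con∈′
      ...     | yes U⊆W | here refl = local-res U W U⊆W

-- From a homomorphism on the level to solutions in 𝔹

module FromHom {𝓢 : Signature} (𝔸 : Structure 𝓢) (𝓘 : Instance 𝓢) (M : ℕ) where
  open Structure 𝔸 using (Rel; Rel?) renaming (universe to A)
  open Instance 𝓘

  Small : ℕ → Set
  Small m = ⌊ smallSets 𝔸 𝓘 m ⌋

  Part : Subset n → FinSet
  Part = PartialSolution 𝔸 𝓘

  𝓔 : DiscreteLC
  𝓔 = record { Var = smallSets 𝔸 𝓘 M ; Dom = Part ∘ value }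

  -- The size bound `k * M` fixes the Sherali-Adams level to start from: a solution at this level
  -- has a value at the union of any k sets of size at most `M`.
  union : ∀ {k} → Vec (Small M) k → Small (k * M)
  union []             = ⊥ , [ Subset.⊥⊆ , ℕ.≤-reflexive (Subset.∣⊥∣≡0 n) ]
  union {suc k} (U ∷ Us) = value U ∪ value (union Us) ,
    Irrelevant.zipWith
      (λ (U⊆ , ∣U∣≤) (W⊆ , ∣W∣≤) → (λ {x} → ∪-lub U⊆ W⊆ {x}) ,
        ℕ.≤-trans (∣p∪q∣≤∣p∣+∣q∣ (value U) (value (union Us))) (ℕ.+-mono-≤ ∣U∣≤ ∣W∣≤))
      (proof U) (proof (union Us))

  Below : Subset n → ∀ {k} → Vec (Small M) k → Set
  Below W = All (λ U → value U ⊆ W)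

  below-union : ∀ {k} (Us : Vec (Small M) k) → Below (value (union Us)) Us
  below-union []       = []
  below-union (U ∷ Us) = (λ {x} → Subset.p⊆p∪q (value (union Us)) {x}) ∷
    All.map (λ V⊆ {x} x∈V → Subset.q⊆p∪q (value U) (value (union Us)) (V⊆ x∈V)) (below-union Us)

  union-least : ∀ {k W} {Us : Vec (Small M) k} → Below W Us → value (union Us) ⊆ W
  union-least []        = Subset.⊥⊆
  union-least (U⊆W ∷ b) = ∪-lub U⊆W (union-least b)

  Parts : ∀ {k} → Vec (Small M) k → FinSet
  Parts = Πᶠ (Part ∘ value)

  restrictAll : ∀ {k W} {Us : Vec (Small M) k} → Below W Us → ⌊ Part W ⌋ → ⌊ Parts Us ⌋
  restrictAll []        f = []
  restrictAll (U⊆W ∷ b) f = res 𝔸 𝓘 U⊆W f ∷ restrictAll b f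

  restrictAll-irrelevant : ∀ {k W} {Us : Vec (Small M) k} (b b′ : Below W Us) f →
                           restrictAll b f ≡ restrictAll b′ f
  restrictAll-irrelevant []        []         f = refl
  restrictAll-irrelevant (p ∷ b) (p′ ∷ b′) f =
    cong₂ _∷_ (res-irrelevant 𝔸 𝓘 p p′ f) (restrictAll-irrelevant b b′ f)

  restrictAll-res : ∀ {k V W} {Us : Vec (Small M) k} (b : Below V Us) (V⊆W : V ⊆ W) (b′ : Below W Us) f →
                    restrictAll b (res 𝔸 𝓘 V⊆W f) ≡ restrictAll b′ f
  restrictAll-res []        V⊆W []         f = refl
  restrictAll-res (p ∷ b) V⊆W (p′ ∷ b′) f =
    cong₂ _∷_ (res-∘ 𝔸 𝓘 p V⊆W p′ f) (restrictAll-res b V⊆W b′ f)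

  reindex-below : ∀ {j k W} (σ : Vec (Fin j) k) {Us : Vec (Small M) j} → Below W Us →
                  Below W (Vec.map (lookup Us) σ)
  reindex-below []      b = []
  reindex-below (i ∷ σ) b = lookup⁺ b i ∷ reindex-below σ b

  lookup-restrictAll : ∀ {k W} {Us : Vec (Small M) k} (b : Below W Us) f i →
                       lookup⁺ (restrictAll b f) i ≡ res 𝔸 𝓘 (lookup⁺ b i) f
  lookup-restrictAll (p ∷ b) f zero    = refl
  lookup-restrictAll (p ∷ b) f (suc i) = lookup-restrictAll b f i

  reindex-restrictAll : ∀ {j k W} (σ : Vec (Fin j) k) {Us : Vec (Small M) j} (b : Below W Us) f →
    reindex (discrete 𝓔) σ (restrictAll b f) ≡ restrictAll (reindex-below σ b) f
  reindex-restrictAll []      b f = refl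
  reindex-restrictAll (i ∷ σ) b f =
    cong₂ _∷_ (lookup-restrictAll b f i) (reindex-restrictAll σ b f)

  -- Since 𝓔 is discrete, the only factors of a product constraint of `pow` are the added
  -- constraints x = id(x). Matching on this equality makes `lhs`, `rhs` and `fun` reduce, so that
  -- `productFun` can be compared with restriction.
  IsIdentity : LCConstraint (smallSets 𝔸 𝓘 M) (Part ∘ value) → Set
  IsIdentity con = ∃[ U ] con ≡ record { lhs = U ; rhs = U ; fun = id }

  open LCConstraint using (lhs; rhs)

  productFun-below : ∀ {k W} {cs : Vec (LCConstraint _ _) k} → All IsIdentity cs →
                     Below W (Vec.map rhs cs) → Below W (Vec.map lhs cs)
  productFun-below []               []      = []
  productFun-below ((_ , refl) ∷ is) (p ∷ b) = p ∷ productFun-below is b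

  productFun-restrictAll : ∀ {k W} {cs : Vec (LCConstraint _ _) k} (is : All IsIdentity cs)
    (b : Below W (Vec.map rhs cs)) f →
    productFun (discrete 𝓔) cs (restrictAll b f) ≡ restrictAll (productFun-below is b) f
  productFun-restrictAll []                []      f = refl
  productFun-restrictAll ((_ , refl) ∷ is) (p ∷ b) f =
    cong (_ ∷_) (productFun-restrictAll is b f)

  identities : ∀ {k} {cs : Vec (LCConstraint _ _) k} →
               cs ∈ˡ vectors (reflexiveClosure (discrete 𝓔)) k → All IsIdentity cs
  identities cs∈ = All.map isIdentity (∈-vectors⁻ (reflexiveClosure (discrete 𝓔)) cs∈)
    where
    isIdentity : ∀ {con} → con ∈ˡ reflexiveClosure (discrete 𝓔) → IsIdentity con
    isIdentity con∈ with ∈-++⁻ (List.map _ (elements (smallSets 𝔸 𝓘 M))) con∈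
    ... | inj₁ con∈ˡ = let U , _ , eq = ∈-map⁻ _ con∈ˡ in U , eq
    ... | inj₂ ()

  module _ {c ℓ} (𝓡 : Minion c ℓ) (j : ℕ) (s : Solution (lc 𝔸 𝓘 (suc j * M)) 𝓡) where
    open Minion 𝓡
    open Solution s using (assign)

    joint : (Us : Vec (Small M) (suc j)) → Elem (Parts Us)
    joint Us = map {Part (value (union Us))} {Parts Us} (restrictAll (below-union Us)) (assign (union Us))

    -- The union is the least common superset, so restriction from W to the entries of `Us` factors
    -- through it, and the value of `s` at the union is itself restricted from W.
    joint-restrict : ∀ (W : Small (suc j * M)) {Us} (b : Below (value W) Us) →
      _≈_ {Parts Us} (joint Us) (map {Part (value W)} {Parts Us} (restrictAll b) (assign W))
    joint-restrict W {Us} b =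
      S.trans (map-cong {Part (value (union Us))} {Parts Us} (λ _ → refl)
                (assign-res 𝔸 𝓘 𝓡 s (union Us) W (union-least b)))
        (S.trans (S.sym (map-∘ {Part (value W)} {Part (value (union Us))} {Parts Us} _ _ (assign W)))
          (map-cong {Part (value W)} {Parts Us}
            (restrictAll-res (below-union Us) (union-least b) b) (Setoid.refl (Obj (Part (value W))))))
      where module S = Setoid (Obj (Parts Us))

    -- Common form of both kinds of constraints of `pow`: the entries of `Us` lie below the union of
    -- `Vs`, and φ carries restrictions to restrictions.
    joint-map : ∀ {Us Vs} (φ : ⌊ Parts Vs ⌋ → ⌊ Parts Us ⌋) (b : Below (value (union Vs)) Us) →
      (∀ f → φ (restrictAll (below-union Vs) f) ≡ restrictAll b f) →
      _≈_ {Parts Us} (joint Us) (map {Parts Vs} {Parts Us} φ (joint Vs))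
    joint-map {Us} {Vs} φ b eq =
      S.trans (joint-restrict (union Vs) b)
        (S.trans (map-cong {Part (value (union Vs))} {Parts Us} (λ f → sym (eq f))
                   (Setoid.refl (Obj (Part (value (union Vs))))))
          (map-∘ {Part (value (union Vs))} {Parts Vs} {Parts Us} φ _ (assign (union Vs))))
      where module S = Setoid (Obj (Parts Us))

    r : Solution (pow (discrete 𝓔) (suc j)) 𝓡
    r = record
      { assign    = joint
      ; satisfies = ListAll.++⁺
          (ListAll.map⁺ (ListAll.tabulate λ {cs} cs∈ → 
            let is = identities cs∈
                b  = below-union (Vec.map rhs cs)
            in joint-map (productFun (discrete 𝓔) cs) (productFun-below is b) (productFun-restrictAll is b)))
          (ListAll.tabulate
            (product (elements (smallSets 𝔸 𝓘 M ^ᶠ suc j)) (elements (Finᶠ (suc j) ^ᶠ suc j))))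
      }
      where
      con : Vec (Small M) (suc j) → Vec (Fin (suc j)) (suc j) → LCConstraint (smallSets 𝔸 𝓘 M ^ᶠ suc j) Parts
      con Us σ = record { lhs = Vec.map (lookup Us) σ ; rhs = Us ; fun = reindex (discrete 𝓔) σ }

      product : ∀ Uss σs {c} → c ∈ˡ List.cartesianProductWith con Uss σs →
                _≈_ {Parts (lhs c)} (joint (lhs c))
                  (map {Parts (rhs c)} {Parts (lhs c)} (LCConstraint.fun c) (joint (rhs c)))
      product Uss σs c∈ with ∈-cartesianProductWith⁻ con Uss σs c∈
      ... | Us , σ , _ , _ , refl = joint-map (reindex (discrete 𝓔) σ)
        (reindex-below σ (below-union Us)) (reindex-restrictAll σ (below-union Us))

    generator : ∀ C U → (⌊ Part (value U) ⌋ → ⌊ C ⌋) → Minion.Elem (level j 𝓡) C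
    generator C U β = 𝓔 , record
      { r         = r
      ; ω         = λ ys → map {Parts (U ∷ ys)} {Frame j 𝓡 𝓔 C ys} (firstOf j 𝓡 𝓔 {C} β) (joint (U ∷ ys))
      ; generated = U , β , λ ys → Setoid.refl (Obj (Frame j 𝓡 𝓔 C ys))
      }

    -- Both ω-families are pushforwards of the same values of `s`, those at the union of V and `ys`.
    -- This union contains U as well, so `joint-restrict` applies to `U ∷ ys` with it.
    generator-res : ∀ {C D U V} (α : ⌊ D ⌋ → ⌊ C ⌋) β γ (U⊆V : value U ⊆ value V) →
      (∀ f → α (γ f) ≡ β (res 𝔸 𝓘 U⊆V f)) →
      LevelEq j 𝓡 (Minion.map (level j 𝓡) {D} {C} α (generator D V γ)) (generator C U β)
    generator-res {C} {D} {U} {V} α β γ U⊆V eq = over record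
      { r≈ = λ ys → Setoid.refl (Obj (Parts ys))
      ; ω≈ = ω≈
      }
      where
      ω≈ : ∀ ys → _≈_ {Frame j 𝓡 𝓔 C ys}
             (map {Frame j 𝓡 𝓔 D ys} {Frame j 𝓡 𝓔 C ys} (first j 𝓡 𝓔 {D} {C} α)
               (map {Parts (V ∷ ys)} {Frame j 𝓡 𝓔 D ys} (firstOf j 𝓡 𝓔 {D} γ) (joint (V ∷ ys))))
             (map {Parts (U ∷ ys)} {Frame j 𝓡 𝓔 C ys} (firstOf j 𝓡 𝓔 {C} β) (joint (U ∷ ys)))
      ω≈ ys
        with below-union (V ∷ ys)
           | joint-restrict (union (V ∷ ys)) {V ∷ ys} | joint-restrict (union (V ∷ ys)) {U ∷ ys}
      ... | V⊆W ∷ b | restrict-V | restrict-U = begin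
        map {FD} {FC} (first j 𝓡 𝓔 {D} {C} α)
          (map {Parts (V ∷ ys)} {FD} (firstOf j 𝓡 𝓔 {D} γ) (joint (V ∷ ys)))
          ≈⟨ map-∘ {Parts (V ∷ ys)} {FD} {FC} _ _ (joint (V ∷ ys)) ⟨
        map {Parts (V ∷ ys)} {FC} (first j 𝓡 𝓔 {D} {C} α ∘ firstOf j 𝓡 𝓔 {D} γ) (joint (V ∷ ys))
          ≈⟨ map-cong {Parts (V ∷ ys)} {FC} (λ _ → refl) (restrict-V (V⊆W ∷ b)) ⟩
        map {Parts (V ∷ ys)} {FC} (first j 𝓡 𝓔 {D} {C} α ∘ firstOf j 𝓡 𝓔 {D} γ)
          (map {Part W} {Parts (V ∷ ys)} (restrictAll (V⊆W ∷ b)) (assign (union (V ∷ ys))))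
          ≈⟨ map-∘ {Part W} {Parts (V ∷ ys)} {FC} _ _ (assign (union (V ∷ ys))) ⟨
        map {Part W} {FC} (first j 𝓡 𝓔 {D} {C} α ∘ firstOf j 𝓡 𝓔 {D} {V} {ys} γ ∘ restrictAll (V⊆W ∷ b))
          (assign (union (V ∷ ys)))
          ≈⟨ map-cong {Part W} {FC}
               (λ f → cong (_, restrictAll b f)
                 (trans (eq _) (cong β (res-∘ 𝔸 𝓘 U⊆V V⊆W (λ {x} x∈U → V⊆W (U⊆V x∈U)) f))))
               (Setoid.refl (Obj (Part W))) ⟩
        map {Part W} {FC} (firstOf j 𝓡 𝓔 {C} β ∘ restrictAll bU) (assign (union (V ∷ ys)))
          ≈⟨ map-∘ {Part W} {Parts (U ∷ ys)} {FC} _ _ (assign (union (V ∷ ys))) ⟩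
        map {Parts (U ∷ ys)} {FC} (firstOf j 𝓡 𝓔 {C} β)
          (map {Part W} {Parts (U ∷ ys)} (restrictAll bU) (assign (union (V ∷ ys))))
          ≈⟨ map-cong {Parts (U ∷ ys)} {FC} (λ _ → refl) (restrict-U bU) ⟨
        map {Parts (U ∷ ys)} {FC} (firstOf j 𝓡 𝓔 {C} β) (joint (U ∷ ys)) ∎
        where
        open import Relation.Binary.Reasoning.Setoid (Obj (Frame j 𝓡 𝓔 C ys))
        W : Subset n
        W = value (union (V ∷ ys))
        FC FD : FinSet
        FC = Frame j 𝓡 𝓔 C ys
        FD = Frame j 𝓡 𝓔 D ys
        bU : Below W (U ∷ ys)
        bU = (λ {x} x∈U → V⊆W (U⊆V x∈U)) ∷ b

    -- Reading off a solution in 𝔹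

    module _ (𝔹 : Structure 𝓢) (𝔸→𝔹 : StructureHom 𝔸 𝔹) (ar≤M : ∀ R → Signature.ar 𝓢 R ≤ M) (1≤M : 1 ≤ M)
             (h : MinionHom (level j 𝓡) (Pol 𝔸 𝔹)) where
      open Signature 𝓢 using (ar)
      open Polymorphism
      private module 𝔹 = Structure 𝔹

      poly : ∀ C U → (⌊ Part (value U) ⌋ → ⌊ C ⌋) → Polymorphism 𝔸 𝔹 C
      poly C U β = Func.to (MinionHom.hom h C) (generator C U β)

      -- By `generator-res` the generator at U is the image under α of the one at V; naturality of
      -- `h` turns this into a relation between polymorphisms.
      poly-res : ∀ {C D U V} (α : ⌊ D ⌋ → ⌊ C ⌋) β γ (U⊆V : value U ⊆ value V) →
        (∀ f → α (γ f) ≡ β (res 𝔸 𝓘 U⊆V f)) →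
        ∀ a → fun (poly C U β) a ≡ fun (poly D V γ) (a ∘ α)
      poly-res {C} {D} {U} {V} α β γ U⊆V eq a =
        trans (sym (Func.cong (MinionHom.hom h C) (generator-res {C} {D} {U} {V} α β γ U⊆V eq) a))
          (MinionHom.natural h {D} {C} α (generator D V γ) a)

      scope : ∀ {k} → Vec (Fin n) k → Subset n
      scope xs = ⋃ (List.map ⁅_⁆ (Vec.toList xs))

      ∣scope∣≤ : ∀ {k} (xs : Vec (Fin n) k) → ∣ scope xs ∣ ≤ k
      ∣scope∣≤ []       = ℕ.≤-reflexive (Subset.∣⊥∣≡0 n)
      ∣scope∣≤ (x ∷ xs) = ℕ.≤-trans (∣p∪q∣≤∣p∣+∣q∣ ⁅ x ⁆ (scope xs))
        (ℕ.+-mono-≤ (ℕ.≤-reflexive (Subset.∣⁅x⁆∣≡1 x)) (∣scope∣≤ xs))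

      ∈-scope : ∀ {k} (xs : Vec (Fin n) k) → All (_∈ scope xs) xs
      ∈-scope []       = []
      ∈-scope (x ∷ xs) = Subset.p⊆p∪q (scope xs) (Subset.x∈⁅x⁆ x) ∷
        All.map (Subset.q⊆p∪q ⁅ x ⁆ (scope xs)) (∈-scope xs)

      scope⊆variables : ∀ {R xs} → (R , xs) ∈ˡ constraints → scope xs ⊆ variables
      scope⊆variables {R} {xs} = go
        where
        go : ∀ {cs} → (R , xs) ∈ˡ cs → scope xs ⊆ ⋃ (List.map (λ (R , xs) → scope xs) cs)
        go {c ∷ cs} (here refl) = Subset.p⊆p∪q _
        go {c ∷ cs} (there c∈)  x∈ = Subset.q⊆p∪q _ _ (go c∈ x∈)

      singleton : ∀ {x} → x ∈ variables → Small M
      singleton {x} x∈ = ⁅ x ⁆ ,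
        [ (λ y∈ → subst (_∈ variables) (sym (Subset.x∈⁅y⁆⇒x≡y x y∈)) x∈)
        , ℕ.≤-trans (ℕ.≤-reflexive (Subset.∣⁅x⁆∣≡1 x)) 1≤M ]

      evaluate : ∀ {U x} → x ∈ U → ⌊ Part U ⌋ → ⌊ A ⌋
      evaluate x∈U f = apply A (value f) x∈U

      solution : Fin n → ⌊ 𝔹.universe ⌋
      solution x with x Subset.∈? variables
      ... | yes x∈ = fun (poly A (singleton x∈) (evaluate (Subset.x∈⁅x⁆ x))) id
      -- A name outside `variables` occurs in no constraint, so an arbitrary element of 𝔹 serves.
      ... | no  _  = StructureHom.fun 𝔸→𝔹 (Structure.nonempty 𝔸)

      -- The values at different variables come from different polymorphisms. The inclusion of the
      -- singleton of x in V expresses them all by the one polymorphism at V, to which `preserves`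
      -- can be applied.
      solution-poly : ∀ {x C V} (α : ⌊ C ⌋ → ⌊ A ⌋) γ (x∈V : x ∈ value V) → value V ⊆ variables →
                      (∀ f → α (γ f) ≡ evaluate x∈V f) → solution x ≡ fun (poly C V γ) α
      solution-poly {x} {C} {V} α γ x∈V V⊆ eq with x Subset.∈? variables
      ... | no x∉  = contradiction (V⊆ x∈V) x∉
      ... | yes x∈ = poly-res {A} {C} {singleton x∈} {V} α (evaluate (Subset.x∈⁅x⁆ x)) γ x⊆V
        (λ f → trans (eq f)
          (trans (cong (apply A (value f)) ([]=-irrelevant _ _))
            (sym (apply-restrict A x⊆V (value f) (Subset.x∈⁅x⁆ x))))) id
        where
        x⊆V : ⁅ x ⁆ ⊆ value V
        x⊆V y∈ = subst (_∈ value V) (sym (Subset.x∈⁅y⁆⇒x≡y x y∈)) x∈V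

      satisfied : ∀ {R xs} → (R , xs) ∈ˡ constraints → 𝔹.Rel R (Vec.map solution xs)
      satisfied {R} {xs} c∈ =
        subst (𝔹.Rel R)
          (trans (sym (Vec.tabulate-∘ (fun p) π))
            (trans (Vec.tabulate-cong (λ i → sym (solution-poly {lookup xs i} {C} {V} (π i) tuple
                (lookup⁺ (∈-scope xs) i) (scope⊆variables c∈) (λ f → lookup-applyAll f (∈-scope xs) i))))
              (trans (Vec.tabulate-∘ solution (lookup xs))
                (cong (Vec.map solution) (Vec.tabulate∘lookup xs)))))
          -- Read at a point of C, the projections π list the tuple that this point is, so they are
          -- related in the power of 𝔸. The membership proof stored in C is irrelevant and is
          -- recovered by decidability.
          (preserves p R (tabulate π) λ c@(t , [ t∈ ]) →
            subst (Rel R) (sym (trans (sym (Vec.tabulate-∘ (λ a → a c) π)) (Vec.tabulate∘lookup t)))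
              (recompute (Rel? R t) t∈))
        where
        V : Small M
        V = scope xs , [ (scope⊆variables c∈) , ℕ.≤-trans (∣scope∣≤ xs) (ar≤M R) ]
        C : FinSet
        C = Subᶠ (A ^ᶠ ar R) (Rel? R)
        tuple : ⌊ Part (scope xs) ⌋ → ⌊ C ⌋
        tuple f = applyAll A (value f) (∈-scope xs) ,
          Irrelevant.map (λ sol → ListAll.lookup sol c∈ (∈-scope xs)) (proof f)
        π : Fin (ar R) → ⌊ C ⌋ → ⌊ A ⌋
        π i c = lookup (value c) i
        p : Polymorphism 𝔸 𝔹 C
        p = poly C V tuple
        lookup-applyAll : ∀ {U k} {xs : Vec (Fin n) k} (f : ⌊ Part U ⌋) (xs⊆U : All (_∈ U) xs) i →
          lookup (applyAll A (value f) xs⊆U) i ≡ evaluate (lookup⁺ xs⊆U i) f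
        lookup-applyAll f (_ ∷ _)    zero    = refl
        lookup-applyAll f (_ ∷ xs⊆U) (suc i) = lookup-applyAll f xs⊆U i

      instanceSolution : InstanceSolution 𝓘 𝔹
      instanceSolution = solution , ListAll.tabulate satisfied

-- Joint laws obtained from a solution of a saturated power

module Joint {c ℓ} (𝓡 : Minion c ℓ) (j : ℕ) (𝓔 : DiscreteLC) (r : Solution (pow (discrete 𝓔) (suc j)) 𝓡) where
  open DiscreteLC 𝓔
  open Minion 𝓡
  open Solution r

  k : ℕ
  k = suc j

  assign-reindex : ∀ (σ : Vec (Fin k) k) zs →
    _≈_ {Πᶠ Dom (Vec.map (lookup zs) σ)} (assign (Vec.map (lookup zs) σ))
      (map {Πᶠ Dom zs} {Πᶠ Dom (Vec.map (lookup zs) σ)} (reindex (discrete 𝓔) σ) (assign zs))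
  assign-reindex σ zs = ListAll.lookup
    (ListAll.++⁻ʳ (List.map _ (vectors (reflexiveClosure (discrete 𝓔)) k)) satisfies)
    (∈-cartesianProductWith⁺ _ (complete (Var ^ᶠ k) zs) (complete (Finᶠ k ^ᶠ k) σ))

  module _ (C : FinSet) where
    Map : ⌊ Var ⌋ → Set
    Map z = ⌊ Dom z ⌋ → ⌊ C ⌋

    Point : Set
    Point = Σ ⌊ Var ⌋ Map

  module _ {C : FinSet} where
    applyMaps : ∀ {n} {zs : Vec ⌊ Var ⌋ n} → All (Map C) zs → ⌊ Πᶠ Dom zs ⌋ → ⌊ C ^ᶠ n ⌋
    applyMaps []       []       = []
    applyMaps (g ∷ gs) (d ∷ ds) = g d ∷ applyMaps gs ds

    zip : ∀ {n} {zs : Vec ⌊ Var ⌋ n} → All (Map C) zs → Vec (Point C) n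
    zip {zs = []}    []       = []
    zip {zs = z ∷ _} (g ∷ gs) = (z , g) ∷ zip gs

    vars : ∀ {n} → Vec (Point C) n → Vec ⌊ Var ⌋ n
    vars = Vec.map proj₁

    maps : ∀ {n} (e : Vec (Point C) n) → All (Map C) (vars e)
    maps []            = []
    maps ((_ , g) ∷ e) = g ∷ maps e

    unzip-zip : ∀ {n} {zs : Vec ⌊ Var ⌋ n} (gs : All (Map C) zs) →
                _≡_ {A = Σ (Vec ⌊ Var ⌋ n) (All (Map C))} (vars (zip gs) , maps (zip gs)) (zs , gs)
    unzip-zip []                    = refl
    unzip-zip {zs = z ∷ _} (g ∷ gs) = cong (λ (zs , gs) → z ∷ zs , g ∷ gs) (unzip-zip gs)

    -- Families of maps over `zs` fit the entries of r, while vectors of points are easily reindexed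
    -- and updated. Packing variables and maps in one dependent pair lets `unzip-zip` pass between
    -- the two forms by `cong`.
    lawAt : Σ (Vec ⌊ Var ⌋ k) (All (Map C)) → Elem (C ^ᶠ k)
    lawAt (zs , gs) = map {Πᶠ Dom zs} {C ^ᶠ k} (applyMaps gs) (assign zs)

    -- In the BLP minion: the joint distribution of (g₁(d₁), …, gₖ(dₖ)), where
    -- e = ((z₁, g₁), …, (zₖ, gₖ)) and (d₁, …, dₖ) is drawn from r at z₁ … zₖ.
    law : Vec (Point C) k → Elem (C ^ᶠ k)
    law e = lawAt (vars e , maps e)

    law-zip : ∀ {zs} (gs : All (Map C) zs) → law (zip gs) ≡ lawAt (zs , gs)
    law-zip gs = cong lawAt (unzip-zip gs)

    private module S = Setoid (Obj (C ^ᶠ k))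

    -- The reindexing constraints of the saturated power, pushed forward: applying maps
    -- coordinatewise commutes with reindexing the coordinates.
    law-reindex : ∀ (σ : Vec (Fin k) k) e →
      S._≈_ (law (Vec.map (lookup e) σ)) (map {C ^ᶠ k} {C ^ᶠ k} (λ v → Vec.map (lookup v) σ) (law e))
    law-reindex σ e = begin
      law (Vec.map (lookup e) σ)
        ≡⟨ cong law (zip-reindex σ e) ⟩
      law (zip (reindexMaps σ (maps e)))
        ≡⟨ law-zip (reindexMaps σ (maps e)) ⟩
      lawAt (Vec.map (lookup (vars e)) σ , reindexMaps σ (maps e))
        ≈⟨ map-cong {Πᶠ Dom zsσ} {C ^ᶠ k} (λ _ → refl) (assign-reindex σ (vars e)) ⟩
      map {Πᶠ Dom zsσ} {C ^ᶠ k} (applyMaps (reindexMaps σ (maps e)))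
        (map {Πᶠ Dom (vars e)} {Πᶠ Dom zsσ} (reindex (discrete 𝓔) σ) (assign (vars e)))
        ≈⟨ map-∘ {Πᶠ Dom (vars e)} {Πᶠ Dom zsσ} {C ^ᶠ k} _ _ (assign (vars e)) ⟨
      map {Πᶠ Dom (vars e)} {C ^ᶠ k} (applyMaps (reindexMaps σ (maps e)) ∘ reindex (discrete 𝓔) σ)
        (assign (vars e))
        ≈⟨ map-cong {Πᶠ Dom (vars e)} {C ^ᶠ k} (applyMaps-reindex σ (maps e))
             (Setoid.refl (Obj (Πᶠ Dom (vars e)))) ⟩
      map {Πᶠ Dom (vars e)} {C ^ᶠ k} ((λ v → Vec.map (lookup v) σ) ∘ applyMaps (maps e)) (assign (vars e))
        ≈⟨ map-∘ {Πᶠ Dom (vars e)} {C ^ᶠ k} {C ^ᶠ k} _ _ (assign (vars e)) ⟩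
      map {C ^ᶠ k} {C ^ᶠ k} (λ v → Vec.map (lookup v) σ) (law e) ∎
      where
      open import Relation.Binary.Reasoning.Setoid (Obj (C ^ᶠ k))

      zsσ : Vec ⌊ Var ⌋ k
      zsσ = Vec.map (lookup (vars e)) σ

      reindexMaps : ∀ {m n} (σ : Vec (Fin m) n) {zs : Vec ⌊ Var ⌋ m} → All (Map C) zs →
                    All (Map C) (Vec.map (lookup zs) σ)
      reindexMaps []      gs = []
      reindexMaps (i ∷ σ) gs = lookup⁺ gs i ∷ reindexMaps σ gs

      lookup-unzip : ∀ {n} (e : Vec (Point C) n) i → lookup e i ≡ (lookup (vars e) i , lookup⁺ (maps e) i)
      lookup-unzip (_ ∷ e) zero    = refl
      lookup-unzip (_ ∷ e) (suc i) = lookup-unzip e i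

      zip-reindex : ∀ {m n} (σ : Vec (Fin m) n) (e : Vec (Point C) m) →
                    Vec.map (lookup e) σ ≡ zip (reindexMaps σ (maps e))
      zip-reindex []      e = refl
      zip-reindex (i ∷ σ) e = cong₂ _∷_ (lookup-unzip e i) (zip-reindex σ e)

      lookup-applyMaps : ∀ {n} {zs : Vec ⌊ Var ⌋ n} (gs : All (Map C) zs) ds i →
                         lookup⁺ gs i (lookup⁺ ds i) ≡ lookup (applyMaps gs ds) i
      lookup-applyMaps (g ∷ gs) (d ∷ ds) zero    = refl
      lookup-applyMaps (g ∷ gs) (d ∷ ds) (suc i) = lookup-applyMaps gs ds i

      applyMaps-reindex : ∀ {m n} (σ : Vec (Fin m) n) {zs : Vec ⌊ Var ⌋ m} (gs : All (Map C) zs) ds →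
        applyMaps (reindexMaps σ gs) (reindex (discrete 𝓔) σ ds) ≡ Vec.map (lookup (applyMaps gs ds)) σ
      applyMaps-reindex []      gs ds = refl
      applyMaps-reindex (i ∷ σ) gs ds = cong₂ _∷_ (lookup-applyMaps gs ds i) (applyMaps-reindex σ gs ds)

    infix 4 _∼_
    -- The two points generate the same ω-family. As r is fixed, this is equality of the generated
    -- elements of the level.
    _∼_ : Point C → Point C → Set ℓ
    (z , g) ∼ (z′ , g′) = ∀ ys → _≈_ {Frame j 𝓡 𝓔 C ys}
      (map {Πᶠ Dom (z ∷ ys)} {Frame j 𝓡 𝓔 C ys} (firstOf j 𝓡 𝓔 {C} g) (assign (z ∷ ys)))
      (map {Πᶠ Dom (z′ ∷ ys)} {Frame j 𝓡 𝓔 C ys} (firstOf j 𝓡 𝓔 {C} g′) (assign (z′ ∷ ys)))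

    ∼-trans : ∀ {p q q′} → p ∼ q → q ∼ q′ → p ∼ q′
    ∼-trans p∼q q∼q′ ys = Setoid.trans (Obj (Frame j 𝓡 𝓔 C ys)) (p∼q ys) (q∼q′ ys)

    ≗⇒∼ : ∀ {z} {g g′ : Map C z} → g ≗ g′ → (z , g) ∼ (z , g′)
    ≗⇒∼ {z} g≗g′ ys = map-cong {Πᶠ Dom (z ∷ ys)} {Frame j 𝓡 𝓔 C ys}
      (λ { (d ∷ ds) → cong (_, ds) (g≗g′ d) }) (Setoid.refl (Obj (Πᶠ Dom (z ∷ ys))))

    -- The law factors through the frame at the variables of `e`, which is exactly where `∼`
    -- compares the two points; the remaining maps are applied afterwards.
    law-∼-head : ∀ {p q} (e : Vec (Point C) j) → p ∼ q → S._≈_ (law (p ∷ e)) (law (q ∷ e))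
    law-∼-head {p} {q} e p∼q =
      S.trans (through p) (S.trans (map-cong {F} {C ^ᶠ k} (λ _ → refl) (p∼q (vars e))) (S.sym (through q)))
      where
      F : FinSet
      F = Frame j 𝓡 𝓔 C (vars e)

      glue : ⌊ F ⌋ → ⌊ C ^ᶠ k ⌋
      glue (c , ds) = c ∷ applyMaps (maps e) ds

      through : ∀ p → S._≈_ (law (p ∷ e)) (map {F} {C ^ᶠ k} glue
        (map {Πᶠ Dom (proj₁ p ∷ vars e)} {F} (firstOf j 𝓡 𝓔 {C} (proj₂ p)) (assign (proj₁ p ∷ vars e))))
      through (z , g) = S.trans
        (map-cong {Πᶠ Dom (z ∷ vars e)} {C ^ᶠ k} (λ { (d ∷ ds) → refl })
          (Setoid.refl (Obj (Πᶠ Dom (z ∷ vars e)))))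
        (map-∘ {Πᶠ Dom (z ∷ vars e)} {F} {C ^ᶠ k} glue (firstOf j 𝓡 𝓔 {C} g) (assign (z ∷ vars e)))

    -- Position i is swapped with position 0, where law-∼-head applies.
    law-∼-update : ∀ {p q} (e : Vec (Point C) k) i → p ∼ q → S._≈_ (law (e [ i ]≔ p)) (law (e [ i ]≔ q))
    law-∼-update (_ ∷ e) zero    p∼q = law-∼-head e p∼q
    law-∼-update {p} {q} (x ∷ e) (suc i) p∼q = begin
      law (x ∷ (e [ i ]≔ p))
        ≡⟨ cong law (swapped p) ⟨
      law (Vec.map (lookup (p ∷ t)) swap)
        ≈⟨ law-reindex swap (p ∷ t) ⟩
      map {C ^ᶠ k} {C ^ᶠ k} _ (law (p ∷ t))
        ≈⟨ map-cong {C ^ᶠ k} {C ^ᶠ k} (λ _ → refl) (law-∼-head t p∼q) ⟩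
      map {C ^ᶠ k} {C ^ᶠ k} _ (law (q ∷ t))
        ≈⟨ law-reindex swap (q ∷ t) ⟨
      law (Vec.map (lookup (q ∷ t)) swap)
        ≡⟨ cong law (swapped q) ⟩
      law (x ∷ (e [ i ]≔ q)) ∎
      where
      open import Relation.Binary.Reasoning.Setoid (Obj (C ^ᶠ k))

      -- The old head x is parked at position i of the tail; the transposition returns it to the
      -- front and moves the new head to position i.
      t : Vec (Point C) j
      t = e [ i ]≔ x

      swap : Vec (Fin k) k
      swap = suc i ∷ (tabulate suc [ i ]≔ zero)

      swapped : ∀ q → Vec.map (lookup (q ∷ t)) swap ≡ x ∷ (e [ i ]≔ q)
      swapped q = cong₂ _∷_ (Vec.lookup∘updateAt i e)
        (trans (Vec.map-[]≔ (lookup (q ∷ t)) (tabulate suc) i)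
          (trans (cong (_[ i ]≔ q) (trans (sym (Vec.tabulate-∘ (lookup (q ∷ t)) suc)) (Vec.tabulate∘lookup t)))
            (Vec.[]≔-idempotent e i)))

    -- Entries are replaced one at a time. Invariant of `go`: each position is either still listed
    -- in `is`, with equivalent entries, or its entries are already equal.
    law-∼ : ∀ (e e′ : Vec (Point C) k) → (∀ i → lookup e i ∼ lookup e′ i) → S._≈_ (law e) (law e′)
    law-∼ e e′ e∼e′ = go (List.allFin k) e (λ i → inj₁ (∈-allFin i , e∼e′ i))
      where
      go : ∀ is (e : Vec (Point C) k) →
           (∀ i → (i ∈ˡ is × lookup e i ∼ lookup e′ i) ⊎ lookup e i ≡ lookup e′ i) →
           S._≈_ (law e) (law e′)
      go []       e h = S.reflexive (cong law
        (trans (sym (Vec.tabulate∘lookup e)) (trans (Vec.tabulate-cong agree) (Vec.tabulate∘lookup e′))))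
        where
        agree : lookup e ≗ lookup e′
        agree i with h i
        ... | inj₂ eq = eq
      go (i ∷ is) e h = S.trans replace (go is (e [ i ]≔ lookup e′ i) h′)
        where
        replace : S._≈_ (law e) (law (e [ i ]≔ lookup e′ i))
        replace with h i
        ... | inj₁ (_ , ∼) = S.trans (S.reflexive (cong law (sym (Vec.[]≔-lookup e i)))) (law-∼-update e i ∼)
        ... | inj₂ eq      = S.reflexive (cong law (trans (sym (Vec.[]≔-lookup e i)) (cong (e [ i ]≔_) eq)))

        h′ : ∀ i′ → (i′ ∈ˡ is × lookup (e [ i ]≔ lookup e′ i) i′ ∼ lookup e′ i′) ⊎
                    lookup (e [ i ]≔ lookup e′ i) i′ ≡ lookup e′ i′
        h′ i′ with i′ Fin.≟ i
        ... | yes refl = inj₂ (Vec.lookup∘updateAt i e)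
        ... | no i′≢i rewrite Vec.lookup∘update′ i′≢i e (lookup e′ i) with h i′
        ...   | inj₁ (here i′≡i , _)  = contradiction i′≡i i′≢i
        ...   | inj₁ (there i′∈ , ∼)  = inj₁ (i′∈ , ∼)
        ...   | inj₂ eq               = inj₂ eq

  constMaps : ∀ {C n z} → Vec (Map C z) n → All (Map C) (replicate n z)
  constMaps {C} []       = []
  constMaps {C} (g ∷ gs) = g ∷ constMaps {C} gs

  zip-constMaps : ∀ {C n z} (gs : Vec (Map C z) n) → zip {C} (constMaps {C} gs) ≡ Vec.map (z ,_) gs
  zip-constMaps     []       = refl
  zip-constMaps {C} (g ∷ gs) = cong (_ ∷_) (zip-constMaps {C} gs)

  -- The entry of r at z z … z is a reindexing of itself along a constant map,
  -- so it lives on the diagonal.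
  law-diagonal : ∀ {C z} (gs : Vec (Map C z) k) → ∃[ ν ] _≈_ {C ^ᶠ k} (law {C} (Vec.map (z ,_) gs))
    (map {Dom z ^ᶠ k} {C ^ᶠ k} (λ v → Vec.map (λ g → g (head v)) gs) ν)
  law-diagonal {C} {z} gs = ν , (begin
    law {C} (Vec.map (z ,_) gs)
      ≡⟨ cong (law {C}) (zip-constMaps {C} gs) ⟨
    law {C} (zip {C} (constMaps {C} gs))
      ≡⟨ law-zip {C} (constMaps {C} gs) ⟩
    lawAt {C} (replicate k z , constMaps {C} gs)
      ≈⟨ map-cong {Πᶠ Dom (replicate k z)} {C ^ᶠ k} (factor gs) (Setoid.refl (Obj (Πᶠ Dom (replicate k z)))) ⟩
    map {Πᶠ Dom (replicate k z)} {C ^ᶠ k} (Vec.zipWith _$_ gs ∘ applyMaps {Dom z} ids) (assign (replicate k z))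
      ≈⟨ map-∘ {Πᶠ Dom (replicate k z)} {Dom z ^ᶠ k} {C ^ᶠ k} _ _ (assign (replicate k z)) ⟩
    map {Dom z ^ᶠ k} {C ^ᶠ k} (Vec.zipWith _$_ gs) (lawAt {Dom z} (replicate k z , ids))
      ≡⟨ cong (map {Dom z ^ᶠ k} {C ^ᶠ k} (Vec.zipWith _$_ gs)) (law-zip {Dom z} ids) ⟨
    map {Dom z ^ᶠ k} {C ^ᶠ k} (Vec.zipWith _$_ gs) (law {Dom z} (zip {Dom z} ids))
      ≡⟨ cong (map {Dom z ^ᶠ k} {C ^ᶠ k} (Vec.zipWith _$_ gs) ∘ law {Dom z}) zip-ids ⟩
    map {Dom z ^ᶠ k} {C ^ᶠ k} (Vec.zipWith _$_ gs) ν
      ≡⟨ cong (map {Dom z ^ᶠ k} {C ^ᶠ k} (Vec.zipWith _$_ gs) ∘ law {Dom z})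
           (Vec.map-replicate (lookup (replicate k (z , id))) zero k) ⟨
    map {Dom z ^ᶠ k} {C ^ᶠ k} (Vec.zipWith _$_ gs)
      (law {Dom z} (Vec.map (lookup (replicate k (z , id))) (replicate k zero)))
      ≈⟨ map-cong {Dom z ^ᶠ k} {C ^ᶠ k} (λ _ → refl)
           (law-reindex {Dom z} (replicate k zero) (replicate k (z , id))) ⟩
    map {Dom z ^ᶠ k} {C ^ᶠ k} (Vec.zipWith _$_ gs)
      (map {Dom z ^ᶠ k} {Dom z ^ᶠ k} (λ v → Vec.map (lookup v) (replicate k zero)) ν)
      ≈⟨ map-∘ {Dom z ^ᶠ k} {Dom z ^ᶠ k} {C ^ᶠ k} _ _ ν ⟨
    map {Dom z ^ᶠ k} {C ^ᶠ k} (λ v → Vec.zipWith _$_ gs (Vec.map (lookup v) (replicate k zero))) ν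
      ≈⟨ map-cong {Dom z ^ᶠ k} {C ^ᶠ k} (λ { v@(_ ∷ _) →
           trans (cong (Vec.zipWith _$_ gs) (Vec.map-replicate (lookup v) zero k))
             (Vec.zipWith-replicate₂ _$_ gs (lookup v zero)) })
           (Setoid.refl (Obj (Dom z ^ᶠ k))) ⟩
    map {Dom z ^ᶠ k} {C ^ᶠ k} (λ v → Vec.map (λ g → g (head v)) gs) ν ∎)
    where
    open import Relation.Binary.Reasoning.Setoid (Obj (C ^ᶠ k))

    ν : Elem (Dom z ^ᶠ k)
    ν = law {Dom z} (replicate k (z , id))

    ids : All (Map (Dom z)) (replicate k z)
    ids = constMaps {Dom z} (replicate k id)

    zip-ids : zip {Dom z} ids ≡ replicate k (z , id)
    zip-ids = trans (zip-constMaps {Dom z} (replicate k id)) (Vec.map-replicate (z ,_) id k)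

    factor : ∀ {n} (gs : Vec (Map C z) n) ds → applyMaps {C} (constMaps {C} gs) ds ≡
             Vec.zipWith _$_ gs (applyMaps {Dom z} (constMaps {Dom z} (replicate n id)) ds)
    factor []       []       = refl
    factor (g ∷ gs) (d ∷ ds) = cong (g d ∷_) (factor gs ds)

-- Total maps cut down to subsets, enumeration of subsets, and padding

module _ {A : FinSet} where
  fromTotal : ∀ {n} (U : Subset n) → (Fin n → ⌊ A ⌋) → ⌊ PartialMap A U ⌋
  fromTotal []            h = []
  fromTotal (inside ∷ U)  h = h zero ∷ fromTotal U (h ∘ suc)
  fromTotal (outside ∷ U) h = tt ∷ fromTotal U (h ∘ suc)

  apply-fromTotal : ∀ {n} (U : Subset n) (h : Fin n → ⌊ A ⌋) {x} (x∈U : x ∈ U) →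
                    apply A (fromTotal U h) x∈U ≡ h x
  apply-fromTotal (inside ∷ U)  h here        = refl
  apply-fromTotal (inside ∷ U)  h (there x∈U) = apply-fromTotal U (h ∘ suc) x∈U
  apply-fromTotal (outside ∷ U) h (there x∈U) = apply-fromTotal U (h ∘ suc) x∈U

  restrict-fromTotal : ∀ {n} {U V : Subset n} (U⊆V : U ⊆ V) {g h : Fin n → ⌊ A ⌋} →
                       (∀ {x} → x ∈ U → g x ≡ h x) →
                       fromTotal U g ≡ restrict A U⊆V (fromTotal V h)
  restrict-fromTotal {U = U} {V} U⊆V {g} {h} g≡h = apply-ext _ _ λ x∈U →
    trans (apply-fromTotal U g x∈U)
      (trans (g≡h x∈U)
        (sym (trans (apply-restrict A U⊆V (fromTotal V h) x∈U) (apply-fromTotal V h (U⊆V x∈U)))))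

  applyAll-fromTotal : ∀ {n} {U : Subset n} (h : Fin n → ⌊ A ⌋) {k} {xs : Vec (Fin n) k}
                       (xs⊆U : All (_∈ U) xs) → applyAll A (fromTotal U h) xs⊆U ≡ Vec.map h xs
  applyAll-fromTotal         h []           = refl
  applyAll-fromTotal {U = U} h (x∈U ∷ xs⊆U) =
    cong₂ _∷_ (apply-fromTotal U h x∈U) (applyAll-fromTotal h xs⊆U)

enumerate : ∀ {n} (U : Subset n) → Vec (Fin n) ∣ U ∣
enumerate []            = []
enumerate (inside ∷ U)  = zero ∷ Vec.map suc (enumerate U)
enumerate (outside ∷ U) = Vec.map suc (enumerate U)

position : ∀ {n} {U : Subset n} {x} → x ∈ U → ∃[ i ] lookup (enumerate U) i ≡ x
position {U = inside ∷ U}  here = zero , refl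
position {U = inside ∷ U}  (there x∈U) = let i , eq = position x∈U in
  suc i , trans (Vec.lookup-map i suc (enumerate U)) (cong suc eq)
position {U = outside ∷ U} (there x∈U) = let i , eq = position x∈U in
  i , trans (Vec.lookup-map i suc (enumerate U)) (cong suc eq)

enumerate-∈ : ∀ {n} (U : Subset n) i → lookup (enumerate U) i ∈ U
enumerate-∈ (inside ∷ U)  zero    = here
enumerate-∈ (inside ∷ U)  (suc i) =
  subst (_∈ inside ∷ U) (sym (Vec.lookup-map i suc (enumerate U))) (there (enumerate-∈ U i))
enumerate-∈ (outside ∷ U) i       =
  subst (_∈ outside ∷ U) (sym (Vec.lookup-map i suc (enumerate U))) (there (enumerate-∈ U i))

module _ {n k : ℕ} (n≤k : n ≤ k) (default : Fin n) where
  -- A left inverse of `inject≤`. Positions beyond n are sent to `default`, so padding a tuple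
  -- repeats one of its own entries and introduces no new ones.
  clamp : Fin k → Fin n
  clamp i with toℕ i ℕ.<? n
  ... | yes i<n = fromℕ< i<n
  ... | no  _   = default

  clamp-inject≤ : ∀ i → clamp (inject≤ i n≤k) ≡ i
  clamp-inject≤ i with toℕ (inject≤ i n≤k) ℕ.<? n
  ... | yes i<n = Fin.toℕ-injective (trans (Fin.toℕ-fromℕ< i<n) (Fin.toℕ-inject≤ i n≤k))
  ... | no  i≮n = contradiction (subst (_< n) (sym (Fin.toℕ-inject≤ i n≤k)) (Fin.toℕ<n i)) i≮n

  module _ {X : Set} where
    pad : Vec X n → Vec X k
    pad xs = tabulate (lookup xs ∘ clamp)

    unpad : Vec X k → Vec X n
    unpad v = tabulate (λ i → lookup v (inject≤ i n≤k))

    lookup-pad : ∀ xs i → lookup (pad xs) i ≡ lookup xs (clamp i)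
    lookup-pad xs = Vec.lookup∘tabulate (lookup xs ∘ clamp)

    lookup-pad-inject≤ : ∀ xs i → lookup (pad xs) (inject≤ i n≤k) ≡ lookup xs i
    lookup-pad-inject≤ xs i = trans (lookup-pad xs (inject≤ i n≤k)) (cong (lookup xs) (clamp-inject≤ i))

  lookup-map-pad : ∀ {X Y : Set} (h : X → Y) xs i → lookup (Vec.map h (pad xs)) i ≡ h (lookup xs (clamp i))
  lookup-map-pad h xs i = trans (Vec.lookup-map i h (pad xs)) (cong h (lookup-pad xs i))

  unpad-map-pad : ∀ {X Y : Set} (h : X → Y) (xs : Vec X n) → unpad (Vec.map h (pad xs)) ≡ Vec.map h xs
  unpad-map-pad h xs = trans
    (Vec.tabulate-cong (λ i →
      trans (Vec.lookup-map (inject≤ i n≤k) h (pad xs)) (cong h (lookup-pad-inject≤ xs i))))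
    (trans (Vec.tabulate-∘ h (lookup xs)) (cong (Vec.map h) (Vec.tabulate∘lookup xs)))

-- Tuples e that list U together with one further element v₀, so that they
-- can be padded to any length above ∣ U ∣ even if U is empty.

module _ {N : ℕ} (v₀ : Fin N) (k : ℕ) where
  Near : Subset N → Fin N → Set
  Near U x = x ∈ U ⊎ x ≡ v₀

  record Cover (U : Subset N) : Set where
    field
      tuple  : Vec (Fin N) k
      pos    : Fin N → Fin k
      covers : ∀ {x} → Near U x → lookup tuple (pos x) ≡ x
      near   : ∀ i → Near U (lookup tuple i)

  cover : ∀ {U} → ∣ U ∣ < k → Cover U
  cover {U} ∣U∣<k = record
    { tuple  = pad ∣U∣<k zero (v₀ ∷ enumerate U)
    ; pos    = λ x → inject≤ (index x) ∣U∣<k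
    ; covers = λ {x} nx →
        trans (lookup-pad-inject≤ ∣U∣<k zero (v₀ ∷ enumerate U) (index x)) (index-correct nx)
    ; near   = λ i →
        subst (Near U) (sym (lookup-pad ∣U∣<k zero (v₀ ∷ enumerate U) i)) (near (clamp ∣U∣<k zero i))
    }
    where
    index : Fin N → Fin (suc ∣ U ∣)
    index x with x ∈? U
    ... | yes x∈U = suc (proj₁ (position x∈U))
    -- Position zero of `v₀ ∷ enumerate U` holds v₀, the only point outside U that `Near` admits.
    ... | no  _   = zero

    index-correct : ∀ {x} → Near U x → lookup (v₀ ∷ enumerate U) (index x) ≡ x
    index-correct {x} nx with x ∈? U | nx
    ... | yes x∈U | _           = proj₂ (position x∈U)
    ... | no x∉U  | inj₁ x∈U    = contradiction x∈U x∉U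
    ... | no _    | inj₂ x≡v₀   = sym x≡v₀

    near : ∀ i → Near U (lookup (v₀ ∷ enumerate U) i)
    near zero    = inj₂ refl
    near (suc i) = inj₁ (enumerate-∈ U i)

-- Laws of partial maps on sets of names

module Naming {c ℓ} (𝓡 : Minion c ℓ) (j : ℕ) (𝓔 : DiscreteLC) (r : Solution (pow (discrete 𝓔) (suc j)) 𝓡)
              {A : FinSet} {N : ℕ} (name : Fin N → Joint.Point 𝓡 j 𝓔 r A) where
  open DiscreteLC 𝓔
  open Minion 𝓡
  open Joint 𝓡 j 𝓔 r

  named : Vec (Fin N) k → Elem (A ^ᶠ k)
  named e = law {A} (Vec.map name e)

  -- The positions in `e′` of the entries of `e` form a vector σ that exhibits `e` as a reindexing
  -- of `e′`.
  named-reindex : ∀ e e′ (pos : Fin N → Fin k) → (∀ i → lookup e′ (pos (lookup e i)) ≡ lookup e i) →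
    _≈_ {A ^ᶠ k} (named e) (map {A ^ᶠ k} {A ^ᶠ k} (λ v → Vec.map (lookup v ∘ pos) e) (named e′))
  named-reindex e e′ pos covers = begin
    named e
      ≡⟨ cong (law {A}) name-e ⟩
    law {A} (Vec.map (lookup (Vec.map name e′)) σ)
      ≈⟨ law-reindex {A} σ (Vec.map name e′) ⟩
    map {A ^ᶠ k} {A ^ᶠ k} (λ v → Vec.map (lookup v) σ) (named e′)
      ≈⟨ map-cong {A ^ᶠ k} {A ^ᶠ k} (λ v → sym (Vec.map-∘ (lookup v) pos e)) (Setoid.refl (Obj (A ^ᶠ k))) ⟩
    map {A ^ᶠ k} {A ^ᶠ k} (λ v → Vec.map (lookup v ∘ pos) e) (named e′) ∎
    where
    open import Relation.Binary.Reasoning.Setoid (Obj (A ^ᶠ k))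

    σ : Vec (Fin k) k
    σ = Vec.map pos e

    name-e : Vec.map name e ≡ Vec.map (lookup (Vec.map name e′)) σ
    name-e = trans (sym (Vec.tabulate∘lookup (Vec.map name e)))
      (trans (Vec.tabulate-cong λ i →
          trans (Vec.lookup-map i name e)
            (trans (cong name (sym (covers i)))
              (trans (sym (Vec.lookup-map (pos (lookup e i)) name e′))
                (trans (cong (lookup (Vec.map name e′)) (sym (Vec.lookup-map i pos e)))
                  (sym (Vec.lookup-map i (lookup (Vec.map name e′)) σ))))))
        (Vec.tabulate∘lookup _))

  module _ {v₀ : Fin N} where
    open Cover

    partialLaw : ∀ {U} → Cover v₀ k U → Elem (PartialMap A U)
    partialLaw {U} cov =
      map {A ^ᶠ k} {PartialMap A U} (λ v → fromTotal U (lookup v ∘ pos cov)) (named (tuple cov))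

    -- The entries of `tuple cu` lie in U or equal v₀, hence all occur in `tuple cv`, and
    -- `named-reindex` applies. For this reason covers of different sets share one v₀.
    partialLaw-restrict : ∀ {U V} (cu : Cover v₀ k U) (cv : Cover v₀ k V) (U⊆V : U ⊆ V) →
      _≈_ {PartialMap A U} (partialLaw cu)
        (map {PartialMap A V} {PartialMap A U} (restrict A U⊆V) (partialLaw cv))
    partialLaw-restrict {U} {V} cu cv U⊆V = begin
      partialLaw cu
        ≈⟨ map-cong {A ^ᶠ k} {PartialMap A U} (λ _ → refl)
             (named-reindex (tuple cu) (tuple cv) (pos cv) (λ i → covers cv (widen (near cu i)))) ⟩
      map {A ^ᶠ k} {PartialMap A U} (λ v → fromTotal U (lookup v ∘ pos cu))
        (map {A ^ᶠ k} {A ^ᶠ k} (λ v → Vec.map (lookup v ∘ pos cv) (tuple cu)) (named (tuple cv)))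
        ≈⟨ map-∘ {A ^ᶠ k} {A ^ᶠ k} {PartialMap A U} _ _ (named (tuple cv)) ⟨
      map {A ^ᶠ k} {PartialMap A U}
        (λ v → fromTotal U (lookup (Vec.map (lookup v ∘ pos cv) (tuple cu)) ∘ pos cu)) (named (tuple cv))
        ≈⟨ map-cong {A ^ᶠ k} {PartialMap A U}
             (λ v → restrict-fromTotal U⊆V λ {x} x∈U →
               trans (Vec.lookup-map (pos cu x) (lookup v ∘ pos cv) (tuple cu))
                 (cong (lookup v ∘ pos cv) (covers cu (inj₁ x∈U))))
             (Setoid.refl (Obj (A ^ᶠ k))) ⟩
      map {A ^ᶠ k} {PartialMap A U} (λ v → restrict A U⊆V (fromTotal V (lookup v ∘ pos cv))) (named (tuple cv))
        ≈⟨ map-∘ {A ^ᶠ k} {PartialMap A V} {PartialMap A U} _ _ (named (tuple cv)) ⟩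
      map {PartialMap A V} {PartialMap A U} (restrict A U⊆V) (partialLaw cv) ∎
      where
      open import Relation.Binary.Reasoning.Setoid (Obj (PartialMap A U))

      widen : ∀ {x} → Near v₀ k U x → Near v₀ k V x
      widen (inj₁ x∈U)  = inj₁ (U⊆V x∈U)
      widen (inj₂ x≡v₀) = inj₂ x≡v₀

    -- After padding to length k, the points named by `xs` may be replaced by the equivalent points
    -- (z, gᵢ). These share the variable z, so `law-diagonal` shows that the values on `xs` are
    -- distributed as (g₁(d), ..., gₙ(d)) for a single d.
    partialLaw-tuple : ∀ {U} (cov : Cover v₀ k U) {n} → n ≤ k → Fin n →
      {xs : Vec (Fin N) n} (xs⊆U : All (_∈ U) xs) {z : ⌊ Var ⌋} (gs : Vec (Map A z) n) →
      (∀ i → _∼_ {A} (name (lookup xs i)) (z , lookup gs i)) →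
      ∃[ ν ] _≈_ {A ^ᶠ n}
        (map {PartialMap A U} {A ^ᶠ n} (λ f → applyAll A f xs⊆U) (partialLaw cov))
        (map {Dom z ^ᶠ k} {A ^ᶠ n} (λ v → Vec.map (λ g → g (head v)) gs) ν)
    partialLaw-tuple {U} cov {n} n≤k i₀ {xs} xs⊆U {z} gs xs∼gs = ν , (begin
      map {PartialMap A U} {A ^ᶠ n} (λ f → applyAll A f xs⊆U) (partialLaw cov)
        ≈⟨ map-∘ {A ^ᶠ k} {PartialMap A U} {A ^ᶠ n} _ _ (named (tuple cov)) ⟨
      map {A ^ᶠ k} {A ^ᶠ n} (λ v → applyAll A (fromTotal U (lookup v ∘ pos cov)) xs⊆U) (named (tuple cov))
        ≈⟨ map-cong {A ^ᶠ k} {A ^ᶠ n}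
             (λ v → trans (applyAll-fromTotal (lookup v ∘ pos cov) xs⊆U)
               (sym (unpad-map-pad n≤k i₀ (lookup v ∘ pos cov) xs)))
             (Setoid.refl (Obj (A ^ᶠ k))) ⟩
      map {A ^ᶠ k} {A ^ᶠ n} (λ v → unpad n≤k i₀ (Vec.map (lookup v ∘ pos cov) (pad n≤k i₀ xs)))
        (named (tuple cov))
        ≈⟨ map-∘ {A ^ᶠ k} {A ^ᶠ k} {A ^ᶠ n} _ _ (named (tuple cov)) ⟩
      map {A ^ᶠ k} {A ^ᶠ n} (unpad n≤k i₀)
        (map {A ^ᶠ k} {A ^ᶠ k} (λ v → Vec.map (lookup v ∘ pos cov) (pad n≤k i₀ xs)) (named (tuple cov)))
        ≈⟨ map-cong {A ^ᶠ k} {A ^ᶠ n} (λ _ → refl)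
             (named-reindex (pad n≤k i₀ xs) (tuple cov) (pos cov) (λ i → covers cov (inj₁ (padded∈U i)))) ⟨
      map {A ^ᶠ k} {A ^ᶠ n} (unpad n≤k i₀) (named (pad n≤k i₀ xs))
        ≈⟨ map-cong {A ^ᶠ k} {A ^ᶠ n} (λ _ → refl)
             (law-∼ {A} (Vec.map name (pad n≤k i₀ xs)) (Vec.map (z ,_) (pad n≤k i₀ gs)) padded∼) ⟩
      map {A ^ᶠ k} {A ^ᶠ n} (unpad n≤k i₀) (law {A} (Vec.map (z ,_) (pad n≤k i₀ gs)))
        ≈⟨ map-cong {A ^ᶠ k} {A ^ᶠ n} (λ _ → refl) (proj₂ (law-diagonal {A} (pad n≤k i₀ gs))) ⟩
      map {A ^ᶠ k} {A ^ᶠ n} (unpad n≤k i₀)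
        (map {Dom z ^ᶠ k} {A ^ᶠ k} (λ v → Vec.map (λ g → g (head v)) (pad n≤k i₀ gs)) ν)
        ≈⟨ map-∘ {Dom z ^ᶠ k} {A ^ᶠ k} {A ^ᶠ n} _ _ ν ⟨
      map {Dom z ^ᶠ k} {A ^ᶠ n} (λ v → unpad n≤k i₀ (Vec.map (λ g → g (head v)) (pad n≤k i₀ gs))) ν
        ≈⟨ map-cong {Dom z ^ᶠ k} {A ^ᶠ n} (λ v → unpad-map-pad n≤k i₀ (λ g → g (head v)) gs)
             (Setoid.refl (Obj (Dom z ^ᶠ k))) ⟩
      map {Dom z ^ᶠ k} {A ^ᶠ n} (λ v → Vec.map (λ g → g (head v)) gs) ν ∎)
      where
      open import Relation.Binary.Reasoning.Setoid (Obj (A ^ᶠ n))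

      ν : Elem (Dom z ^ᶠ k)
      ν = proj₁ (law-diagonal {A} (pad n≤k i₀ gs))

      padded∈U : ∀ i → lookup (pad n≤k i₀ xs) i ∈ U
      padded∈U i = subst (_∈ U) (sym (lookup-pad n≤k i₀ xs i)) (lookup⁺ xs⊆U (clamp n≤k i₀ i))

      padded∼ : ∀ i → _∼_ {A} (lookup (Vec.map name (pad n≤k i₀ xs)) i)
                              (lookup (Vec.map (z ,_) (pad n≤k i₀ gs)) i)
      padded∼ i = subst₂ (_∼_ {A})
        (sym (lookup-map-pad n≤k i₀ name xs i)) (sym (lookup-map-pad n≤k i₀ (z ,_) gs i))
        (xs∼gs (clamp n≤k i₀ i))

-- Supports, enumeration of functions, and canonical choices

-- All that the converse needs to know about BLP: which points have
-- probability 0, and that a distribution supported on a subset can be regarded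
-- as a distribution on that subset.

record SupportTheory (𝓡 : Minion 0ℓ 0ℓ) : Set₁ where
  open Minion 𝓡
  field
    Null                : ∀ {D} → Elem D → ⌊ D ⌋ → Set

  Supported : ∀ {D} → Elem D → (⌊ D ⌋ → Set) → Set
  Supported {D} μ P = ∀ a → ¬ P a → Null {D} μ a

  field
    supported-cong      : ∀ {D P} {μ ν : Elem D} → _≈_ {D} μ ν → Supported {D} μ P → Supported {D} ν P
    supported-image     : ∀ {D E P} {α : ⌊ D ⌋ → ⌊ E ⌋} (μ : Elem D) → (∀ d → P (α d)) →
                          Supported {E} (map {D} {E} α μ) P
    supported-preimage  : ∀ {D E P} {α : ⌊ D ⌋ → ⌊ E ⌋} (μ : Elem D) →
                          Supported {E} (map {D} {E} α μ) P → Supported {D} μ (P ∘ α)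
    map-injective       : ∀ {D E} {α : ⌊ D ⌋ → ⌊ E ⌋} → Injective _≡_ _≡_ α → (μ ν : Elem D) →
                          _≈_ {E} (map {D} {E} α μ) (map {D} {E} α ν) → _≈_ {D} μ ν
    condition           : ∀ {D P} (P? : Decidable P) (μ : Elem D) → Supported {D} μ P → Elem (Subᶠ D P?)
    map-value-condition : ∀ {D P} (P? : Decidable P) (μ : Elem D) (supp : Supported {D} μ P) →
                          _≈_ {D} (map {Subᶠ D P?} {D} value (condition P? μ supp)) μ

-- Functions are tabulated along `elements D`. The list is complete up to pointwise equality, which
-- `≗⇒∼` absorbs when points are named.
functions : (D A : FinSet) → List (⌊ D ⌋ → ⌊ A ⌋)
functions D A =
  List.map (λ w d → lookup w (Any.index (complete D d))) (elements (A ^ᶠ List.length (elements D)))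

functions-complete : ∀ D A (g : ⌊ D ⌋ → ⌊ A ⌋) → ∃[ g′ ] g′ ∈ˡ functions D A × g′ ≗ g
functions-complete D A g = _ , ∈-map⁺ _ (complete (A ^ᶠ _) (tabulate (g ∘ List.lookup (elements D)))) , λ d →
  trans (Vec.lookup∘tabulate _ (Any.index (complete D d))) (cong g (sym (lookup-index (complete D d))))

headOr : {A : Set} → A → List A → A
headOr a []      = a
headOr _ (a ∷ _) = a

module _ {A : Set} where
  headOr-∈ : ∀ a {x : A} {xs} → x ∈ˡ xs → headOr a xs ∈ˡ xs
  headOr-∈ a (here _)  = here refl
  headOr-∈ a (there _) = here refl

  headOr-irrelevant : ∀ a b {x : A} {xs} → x ∈ˡ xs → headOr a xs ≡ headOr b xs
  headOr-irrelevant a b (here _)  = refl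
  headOr-irrelevant a b (there _) = refl

-- Trades a given proof for the one stored in the decision, so that the result no longer depends on
-- which proof was given.
fromDec : {P : Set} → Dec P → P → P
fromDec (yes p) _ = p
fromDec (no ¬p) p = contradiction p ¬p

fromDec-irrelevant : {P : Set} (d : Dec P) (p q : P) → fromDec d p ≡ fromDec d q
fromDec-irrelevant (yes _) p q = refl
fromDec-irrelevant (no ¬p) p q = contradiction p ¬p

-- From a Sherali-Adams solver to a homomorphism on the level

module FromSolver (𝓡 : Minion 0ℓ 0ℓ) (supports : SupportTheory 𝓡) (em : ExcludedMiddle 0ℓ)
  {𝓢 : Signature} (𝔸 𝔹 : Structure 𝓢) (m M : ℕ)
  (ar≤M : ∀ R → Signature.ar 𝓢 R ≤ M)
  (solver : (𝓘 : Instance 𝓢) → Solution (lc 𝔸 𝓘 m) 𝓡 → InstanceSolution 𝓘 𝔹) where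

  open Signature 𝓢
  open Minion 𝓡
  open SupportTheory supports
  open Structure 𝔸 using (Rel; nonempty) renaming (universe to A)
  private module 𝔹 = Structure 𝔹

  -- Tuples of length k have room for a set of at most m names together with one extra name, and for
  -- the tuple of any constraint.
  j k : ℕ
  j = m + M
  k = suc j

  module _ (𝓔 : DiscreteLC) where
    open DiscreteLC 𝓔

    Point : Set
    Point = Σ ⌊ Var ⌋ (λ z → ⌊ Dom z ⌋ → ⌊ A ⌋)

    points : List Point
    points = concatMap (λ z → List.map (z ,_) (functions (Dom z) A)) (elements Var)

    N : ℕ
    N = List.length points

    -- Names depend on 𝓔 alone, so that the instances built from different r are lists of
    -- constraints over the same `Fin N`. The identification of points, which depends on r, enters
    -- through `Named`.
    name : Fin N → Point
    name = List.lookup points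

    points-complete : ∀ z g → ∃[ g′ ] (z , g′) ∈ˡ points × g′ ≗ g
    points-complete z g =
      let g′ , g′∈ , g′≗g = functions-complete (Dom z) A g
      in g′ , ∈-concatMap⁺ _ (Any.map (λ { refl → ∈-map⁺ (z ,_) g′∈ }) (complete Var z)) , g′≗g

    Constraint : Set
    Constraint = Σ[ R ∈ ⌊ Symbol ⌋ ] Vec (Fin N) (ar R)

    allConstraints : List Constraint
    allConstraints = concatMap (λ R → List.map (R ,_) (elements (Finᶠ N ^ᶠ ar R))) (elements Symbol)

    ∈-allConstraints : ∀ c → c ∈ˡ allConstraints
    ∈-allConstraints (R , xs) =
      ∈-concatMap⁺ _ (Any.map (λ { refl → ∈-map⁺ (R ,_) (complete (Finᶠ N ^ᶠ ar R) xs) }) (complete Symbol R))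

    inst : List Constraint → Instance 𝓢
    inst cs = record { n = N ; constraints = cs }

    -- The hypothesis may return a different solution for each Sherali–Adams
    -- solution; the one picked by excluded middle depends on the list of
    -- constraints only, and hence on r only up to ≈.
    choose : ∀ cs → InstanceSolution (inst cs) 𝔹 → Fin N → ⌊ 𝔹.universe ⌋
    choose cs s = proj₁ (fromDec em s)

    choose-cong : ∀ {cs cs′} s s′ → cs ≡ cs′ → choose cs s ≡ choose cs′ s′
    choose-cong s s′ refl = cong proj₁ (fromDec-irrelevant em s s′)

    module _ (r : Solution (pow (discrete 𝓔) k) 𝓡) where
      open Joint 𝓡 j 𝓔 r using (_∼_; ≗⇒∼)
      open Naming 𝓡 j 𝓔 r {A} {N} name

      Named : Point → Fin N → Set
      Named p i = _∼_ {A} (name i) p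

      named-by : ∀ p → ∃[ i ] Named p i
      named-by (z , g) =
        let g′ , g′∈ , g′≗g = points-complete z g
        in Any.index g′∈ , subst (λ p → _∼_ {A} p (z , g)) (lookup-index g′∈) (≗⇒∼ {A} g′≗g)

      opaque
        -- The first name of p, so that equivalent points get the same representative.
        rep : Point → Fin N
        rep p = headOr (proj₁ (named-by p)) (filter (λ i → em {Named p i}) (allFin N))

        name-rep : ∀ p → Named p (rep p)
        name-rep p = let i , named = named-by p in
          proj₂ (∈-filter⁻ (λ i → em {Named p i}) {xs = allFin N}
            (headOr-∈ i (∈-filter⁺ (λ i → em {Named p i}) (∈-allFin i) named)))

      -- All maps are taken over one common z; this is what makes the law of a constraint
      -- concentrate on the diagonal and thereby on the relation.
      Holds : Constraint → Set
      Holds (R , xs) = Σ[ z ∈ ⌊ Var ⌋ ] Σ[ gs ∈ Vec (⌊ Dom z ⌋ → ⌊ A ⌋) (ar R) ]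
        (∀ i → Named (z , lookup gs i) (lookup xs i)) × (∀ d → Rel R (Vec.map (λ g → g d) gs))

      holding : List Constraint
      holding = filter (λ c → em {Holds c}) allConstraints

      module _ (z₀ : ⌊ Var ⌋) where
        𝓘 : Instance 𝓢
        𝓘 = inst holding

        -- `Fin N` is inhabited only if 𝓔 has a variable, which z₀ guarantees. This name only fills
        -- up tuples, so any name would do.
        v₀ : Fin N
        v₀ = rep (z₀ , const nonempty)

        covering : (U : ⌊ smallSets 𝔸 𝓘 m ⌋) → Cover v₀ k (value U)
        covering (U , [ small ]) = cover v₀ k
          (s≤s (ℕ.≤-trans (recompute (∣ U ∣ ℕ.≤? m) (proj₂ small)) (ℕ.m≤m+n m M)))

        -- A partial map that is no partial solution violates some constraint with scope inside U.
        -- By `partialLaw-tuple` the law of the values on that scope is a pushforward along a map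
        -- into the relation, so its support, pulled back, excludes the violating map.
        partialLaw-supported : ∀ {U} (cov : Cover v₀ k U) →
          Supported {PartialMap A U} (partialLaw cov) (IsPartialSolution 𝔸 𝓘 U)
        partialLaw-supported {U} cov f ¬sol
          with find (ListAll.¬All⇒Any¬ (λ _ → em) holding ¬sol)
        ... | (R , xs) , c∈ , ¬rel with All.all? (Subset._∈? U) xs
        ...   | no  xs⊈U = contradiction (λ xs⊆U → contradiction xs⊆U xs⊈U) ¬rel
        ...   | yes xs⊆U =
          let z , gs , xs∼gs , rel = proj₂ (∈-filter⁻ (λ c → em {Holds c}) {xs = allConstraints} c∈)
              ν , law≈ = partialLaw-tuple cov (ℕ.≤-trans (ar≤M R) (ℕ.≤-trans (ℕ.m≤n+m M m) (ℕ.n≤1+n j)))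
                           -- Positive arity supplies the entry that padding repeats.
                           (fromℕ< (ar≥1 R)) xs⊆U gs xs∼gs
              α : ⌊ Dom z ^ᶠ k ⌋ → ⌊ A ^ᶠ ar R ⌋
              α v = Vec.map (λ g → g (head v)) gs
              φ : ⌊ PartialMap A U ⌋ → ⌊ A ^ᶠ ar R ⌋
              φ f = applyAll A f xs⊆U
          in supported-preimage {PartialMap A U} {A ^ᶠ ar R} {Rel R} {φ} (partialLaw cov)
               (supported-cong {A ^ᶠ ar R} {Rel R} (Setoid.sym (Obj (A ^ᶠ ar R)) law≈)
                 (supported-image {Dom z ^ᶠ k} {A ^ᶠ ar R} {Rel R} {α} ν (λ v → rel (head v))))
               f (λ Rf → ¬rel λ xs⊆U′ →
                 subst (Rel R ∘ applyAll A f) (All.irrelevant []=-irrelevant xs⊆U xs⊆U′) Rf)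

        local : ∀ U → Elem (PartialSolution 𝔸 𝓘 (value U))
        local U = condition (isPartialSolution? 𝔸 𝓘 (value U)) (partialLaw (covering U))
          (partialLaw-supported (covering U))

        map-value-local : ∀ U → _≈_ {PartialMap A (value U)}
          (map {PartialSolution 𝔸 𝓘 (value U)} {PartialMap A (value U)} value (local U)) (partialLaw (covering U))
        map-value-local U = map-value-condition (isPartialSolution? 𝔸 𝓘 (value U)) (partialLaw (covering U))
          (partialLaw-supported (covering U))

        -- Pushing forward along the injective `value` undoes the conditioning, so the equation may
        -- be checked on all partial maps, where it is `partialLaw-restrict`.
        local-res : ∀ U V (U⊆V : value U ⊆ value V) →
          _≈_ {PartialSolution 𝔸 𝓘 (value U)} (local U)
            (map {PartialSolution 𝔸 𝓘 (value V)} {PartialSolution 𝔸 𝓘 (value U)} (res 𝔸 𝓘 U⊆V) (local V))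
        local-res U V U⊆V =
          map-injective {SU} {PU} value-injective (local U) (map {SV} {SU} (res 𝔸 𝓘 U⊆V) (local V)) (begin
            map {SU} {PU} value (local U)
              ≈⟨ map-value-local U ⟩
            partialLaw (covering U)
              ≈⟨ partialLaw-restrict (covering U) (covering V) U⊆V ⟩
            map {PV} {PU} (restrict A U⊆V) (partialLaw (covering V))
              ≈⟨ map-cong {PV} {PU} (λ _ → refl) (map-value-local V) ⟨
            map {PV} {PU} (restrict A U⊆V) (map {SV} {PV} value (local V))
              ≈⟨ map-∘ {SV} {PV} {PU} (restrict A U⊆V) value (local V) ⟨
            map {SV} {PU} (restrict A U⊆V ∘ value) (local V)
              ≈⟨ map-∘ {SV} {SU} {PU} value (res 𝔸 𝓘 U⊆V) (local V) ⟩
            map {SU} {PU} value (map {SV} {SU} (res 𝔸 𝓘 U⊆V) (local V)) ∎)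
          where
          PU PV SU SV : FinSet
          PU = PartialMap A (value U)
          PV = PartialMap A (value V)
          SU = PartialSolution 𝔸 𝓘 (value U)
          SV = PartialSolution 𝔸 𝓘 (value V)
          open import Relation.Binary.Reasoning.Setoid (Obj PU)

        solved : InstanceSolution 𝓘 𝔹
        solved = solver 𝓘 (lcSolution 𝔸 𝓘 𝓡 local local-res)

        opaque
          value-of : Fin N → ⌊ 𝔹.universe ⌋
          value-of = choose holding solved

          value-of-satisfies : ∀ {R xs} → Holds (R , xs) → 𝔹.Rel R (Vec.map value-of xs)
          value-of-satisfies {R} {xs} h = ListAll.lookup (proj₂ (fromDec em solved))
            (∈-filter⁺ (λ c → em {Holds c}) (∈-allConstraints (R , xs)) h)

    opaque
      unfolding value-of

      -- The Sherali-Adams solutions for r and r′ may differ as data, and so may the filling points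
      -- from z and z′, but `choose` depends on the constraint list only.
      value-of-cong : ∀ r r′ z z′ → holding r ≡ holding r′ → value-of r z ≡ value-of r′ z′
      value-of-cong r r′ z z′ = choose-cong {holding r} {holding r′} (solved r z) (solved r′ z′)

    opaque
      unfolding rep

      -- Both filters select the same list of names. It is nonempty by `named-by`, so the fallback
      -- value of `headOr` does not affect its head.
      rep-cong : ∀ r r′ {p q} → (∀ i → Named r p i → Named r′ q i) → (∀ i → Named r′ q i → Named r p i) →
                 rep r p ≡ rep r′ q
      rep-cong r r′ {p} {q} to from =
        trans (headOr-irrelevant _ (proj₁ (named-by r′ q))
                (∈-filter⁺ (λ i → em {Named r p i}) (∈-allFin _) (proj₂ (named-by r p))))
          (cong (headOr (proj₁ (named-by r′ q)))
            (List.filter-≐ (λ i → em {Named r p i}) (λ i → em {Named r′ q i})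
                ((λ {i} → to i) , (λ {i} → from i)) (allFin N)))

    holding-cong : ∀ r r′ → (∀ {p i} → Named r p i → Named r′ p i) → (∀ {p i} → Named r′ p i → Named r p i) →
                   holding r ≡ holding r′
    holding-cong r r′ to from =
      List.filter-≐ (λ c → em {Holds r c}) (λ c → em {Holds r′ c})
        ( (λ (z , gs , ∼ , rel) → z , gs , (λ i → to (∼ i)) , rel)
        , (λ (z , gs , ∼ , rel) → z , gs , (λ i → from (∼ i)) , rel))
        allConstraints

    polymorphism : ∀ {C} → LevelElem j 𝓡 𝓔 C → Polymorphism 𝔸 𝔹 C
    polymorphism {C} u = record
      { fun       = λ a → value-of r z (rep r (z , a ∘ β))
      ; fun-cong  = λ {a} {a′} a≗a′ → cong (value-of r z) (rep-cong r r
          (λ i named → Joint.∼-trans 𝓡 j 𝓔 r {A} named (Joint.≗⇒∼ 𝓡 j 𝓔 r {A} (a≗a′ ∘ β)))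
          (λ i named → Joint.∼-trans 𝓡 j 𝓔 r {A} named (Joint.≗⇒∼ 𝓡 j 𝓔 r {A} (sym ∘ a≗a′ ∘ β))))
      ; preserves = λ R t h → subst (𝔹.Rel R) (sym (Vec.map-∘ (value-of r z) (λ a → rep r (z , a ∘ β)) t))
          -- The points (z, tᵢ ∘ β) satisfy the relation at every d because t does at the coordinate
          -- β d.
          (value-of-satisfies r z
            ( z , Vec.map (_∘ β) t
            , (λ i → subst₂ (λ g x → Named r (z , g) x)
                 (sym (Vec.lookup-map i (_∘ β) t)) (sym (Vec.lookup-map i (λ a → rep r (z , a ∘ β)) t))
                 (name-rep r (z , lookup t i ∘ β)))
            , (λ d → subst (Rel R) (Vec.map-∘ (λ g → g d) (_∘ β) t) (h (β d)))))
      }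
      where
      open LevelElem u
      z : ⌊ Var ⌋
      z = proj₁ generated
      β : ⌊ Dom z ⌋ → ⌊ C ⌋
      β = proj₁ (proj₂ generated)

    framed : Solution (pow (discrete 𝓔) k) 𝓡 → Point → ∀ ys → Elem (Frame j 𝓡 𝓔 A ys)
    framed r (z , g) ys =
      map {Πᶠ Dom (z ∷ ys)} {Frame j 𝓡 𝓔 A ys} (firstOf j 𝓡 𝓔 {A} g) (Solution.assign r (z ∷ ys))

    -- The right-hand side mentions only ω. This frees the class of the point (z, a ∘ β) from the
    -- choice of z and β in `generated`.
    framed-generated : ∀ {C} (u : LevelElem j 𝓡 𝓔 C) (a : ⌊ C ⌋ → ⌊ A ⌋) →
      let open LevelElem u ; z , β , _ = generated in ∀ ys →
      _≈_ {Frame j 𝓡 𝓔 A ys} (framed r (z , a ∘ β) ys)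
        (map {Frame j 𝓡 𝓔 C ys} {Frame j 𝓡 𝓔 A ys} (first j 𝓡 𝓔 {C} {A} a) (ω ys))
    framed-generated {C} u a ys =
      let open LevelElem u ; z , β , ω≈ = generated in
      S.sym (S.trans (map-cong {Frame j 𝓡 𝓔 C ys} {Frame j 𝓡 𝓔 A ys} (λ _ → refl) (ω≈ ys))
        (S.trans
          (S.sym (map-∘ {Πᶠ Dom (z ∷ ys)} {Frame j 𝓡 𝓔 C ys} {Frame j 𝓡 𝓔 A ys} _ _
            (Solution.assign r (z ∷ ys))))
          (map-cong {Πᶠ Dom (z ∷ ys)} {Frame j 𝓡 𝓔 A ys} (λ { (d ∷ ds) → refl })
            (Setoid.refl (Obj (Πᶠ Dom (z ∷ ys)))))))
      where module S = Setoid (Obj (Frame j 𝓡 𝓔 A ys))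

    framed-cong : ∀ r r′ → (∀ zs → _≈_ {Πᶠ Dom zs} (Solution.assign r zs) (Solution.assign r′ zs)) →
                  ∀ p ys → _≈_ {Frame j 𝓡 𝓔 A ys} (framed r p ys) (framed r′ p ys)
    framed-cong r r′ r≈ (z , g) ys = map-cong {Πᶠ Dom (z ∷ ys)} {Frame j 𝓡 𝓔 A ys} (λ _ → refl) (r≈ (z ∷ ys))

    Named-cong : ∀ r r′ {p p′} → (∀ zs → _≈_ {Πᶠ Dom zs} (Solution.assign r zs) (Solution.assign r′ zs)) →
                 (∀ ys → _≈_ {Frame j 𝓡 𝓔 A ys} (framed r p ys) (framed r′ p′ ys)) →
                 ∀ i → Named r p i → Named r′ p′ i
    Named-cong r r′ {p} {p′} r≈ p≈ i named ys = begin
      framed r′ (name i) ys  ≈⟨ framed-cong r r′ r≈ (name i) ys ⟨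
      framed r (name i) ys   ≈⟨ named ys ⟩
      framed r p ys          ≈⟨ p≈ ys ⟩
      framed r′ p′ ys        ∎
      where
      open import Relation.Binary.Reasoning.Setoid (Obj (Frame j 𝓡 𝓔 A ys))

    -- Equality of the r-components gives the same naming relation, hence the same constraints and
    -- the same chosen solution. Equality of the ω-components gives equivalent points, hence the
    -- same representative.
    polymorphism-cong : ∀ {C} {u v : LevelElem j 𝓡 𝓔 C} → _≋_ j 𝓡 𝓔 u v →
                        Polymorphism.fun (polymorphism u) ≗ Polymorphism.fun (polymorphism v)
    polymorphism-cong {C} {u} {v} u≋v a = trans
      (cong (value-of u.r zᵤ) (rep-cong u.r v.r {pᵤ} {pᵥ} (Named-cong u.r v.r {pᵤ} {pᵥ} r≈ same)
        (Named-cong v.r u.r {pᵥ} {pᵤ} r≈′ λ ys → Setoid.sym (Obj (Frame j 𝓡 𝓔 A ys)) (same ys))))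
      (cong-app
        (value-of-cong u.r v.r zᵤ zᵥ (holding-cong u.r v.r
          (λ {p} {i} → Named-cong u.r v.r {p} {p} r≈ (framed-cong u.r v.r r≈ p) i)
          (λ {p} {i} → Named-cong v.r u.r {p} {p} r≈′ (framed-cong v.r u.r r≈′ p) i)))
        (rep v.r pᵥ))
      where
      open _≋_ u≋v
      module u = LevelElem u
      module v = LevelElem v

      zᵤ zᵥ : ⌊ Var ⌋
      zᵤ = proj₁ u.generated
      zᵥ = proj₁ v.generated

      pᵤ pᵥ : Point
      pᵤ = zᵤ , a ∘ proj₁ (proj₂ u.generated)
      pᵥ = zᵥ , a ∘ proj₁ (proj₂ v.generated)

      r≈′ : ∀ zs → _≈_ {Πᶠ Dom zs} (Solution.assign v.r zs) (Solution.assign u.r zs)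
      r≈′ zs = Setoid.sym (Obj (Πᶠ Dom zs)) (r≈ zs)

      same : ∀ ys → _≈_ {Frame j 𝓡 𝓔 A ys} (framed u.r pᵤ ys) (framed v.r pᵥ ys)
      same ys = begin
        framed u.r pᵤ ys
          ≈⟨ framed-generated u a ys ⟩
        map {Frame j 𝓡 𝓔 C ys} {Frame j 𝓡 𝓔 A ys} (first j 𝓡 𝓔 {C} {A} a) (u.ω ys)
          ≈⟨ map-cong {Frame j 𝓡 𝓔 C ys} {Frame j 𝓡 𝓔 A ys} (λ _ → refl) (ω≈ ys) ⟩
        map {Frame j 𝓡 𝓔 C ys} {Frame j 𝓡 𝓔 A ys} (first j 𝓡 𝓔 {C} {A} a) (v.ω ys)
          ≈⟨ framed-generated v a ys ⟨
        framed v.r pᵥ ys ∎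
        where open import Relation.Binary.Reasoning.Setoid (Obj (Frame j 𝓡 𝓔 A ys))

  minionHom : MinionHom (level (m + M) 𝓡) (Pol 𝔸 𝔹)
  minionHom = record
    { hom     = λ C → record
      { to   = λ (𝓔 , u) → polymorphism 𝓔 u
      ; cong = λ { (over {𝓔} u≋v) → polymorphism-cong 𝓔 u≋v }
      }
    -- `mapLevel` keeps r and z and replaces β by α ∘ β, so both sides evaluate the same point.
    ; natural = λ _ _ _ → refl
    }

-- Supports and conditioning of probability distributions

≤ℝ-antisym : ∀ {x y} → x ≤ℝ y → y ≤ℝ x → x ≈ℝ y
≤ℝ-antisym {x} {y} x≤y y≤x ε 0<ε =
  let N , h = x≤y ε 0<ε ; N′ , h′ = y≤x ε 0<ε in
  N ⊔ N′ , λ n N≤n → bound (seq x n) (seq y n)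
    (h n (ℕ.≤-trans (ℕ.m≤m⊔n N N′) N≤n)) (h′ n (ℕ.≤-trans (ℕ.m≤n⊔m N N′) N≤n))
  where
  open +-*-Solver

  difference : ∀ a b → a ℚ.< b ℚ.+ ε → a ℚ.- b ℚ.< ε
  difference a b a<b+ε = subst (a ℚ.- b ℚ.<_) (solve 2 (λ b ε → (b :+ ε) :- b := ε) refl b ε)
    (ℚ.+-monoˡ-< (ℚ.- b) a<b+ε)

  bound : ∀ a b → a ℚ.< b ℚ.+ ε → b ℚ.< a ℚ.+ ε → ℚ.∣ a ℚ.- b ∣ ℚ.< ε
  bound a b a<b+ε b<a+ε with ℚ.∣p∣≡p∨∣p∣≡-p (a ℚ.- b)
  ... | inj₁ eq = subst (ℚ._< ε) (sym eq) (difference a b a<b+ε)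
  ... | inj₂ eq = subst (ℚ._< ε) (sym (trans eq (ℚ-lemmas.minus-swap a b))) (difference b a b<a+ε)

∈⇒≤∑ : {A : Set} {f : A → ℝ} → (∀ a → 0ℝ ≤ℝ f a) → ∀ {x xs} → x ∈ˡ xs → f x ≤ℝ ∑ xs f
∈⇒≤∑ {f = f} 0≤f {x} {x ∷ xs} (here refl) =
  ≤ℝ-trans {f x} {f x +ℝ 0ℝ} {f x +ℝ ∑ xs f}
    (≈ℝ⇒≤ℝ {f x} {f x +ℝ 0ℝ} (≈ℝ.sym {f x +ℝ 0ℝ} {f x} (≈ℝ.identityʳ (f x))))
    (+ℝ-mono-≤ℝ {f x} {f x} {0ℝ} {∑ xs f} (≈ℝ⇒≤ℝ {f x} {f x} (≈ℝ.refl {f x})) (∑-nonneg xs 0≤f))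
∈⇒≤∑ {f = f} 0≤f {x} {y ∷ xs} (there x∈) =
  ≤ℝ-trans {f x} {∑ xs f} {f y +ℝ ∑ xs f} (∈⇒≤∑ {f = f} 0≤f x∈)
    (≤ℝ-trans {∑ xs f} {0ℝ +ℝ ∑ xs f} {f y +ℝ ∑ xs f}
      (≈ℝ⇒≤ℝ {∑ xs f} {0ℝ +ℝ ∑ xs f} (≈ℝ.sym {0ℝ +ℝ ∑ xs f} {∑ xs f} (≈ℝ.identityˡ (∑ xs f))))
      (+ℝ-mono-≤ℝ {0ℝ} {f y} {∑ xs f} {∑ xs f} (0≤f y) (≈ℝ⇒≤ℝ {∑ xs f} {∑ xs f} (≈ℝ.refl {∑ xs f}))))

fibreSum-empty : ∀ D E (α : ⌊ D ⌋ → ⌊ E ⌋) f b → (∀ a → ¬ α a ≡ b) → fibreSum D E α f b ≈ℝ 0ℝ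
fibreSum-empty D E α f b α≢b = ≡⇒≈ℝ {fibreSum D E α f b} {0ℝ} (cong (λ as → ∑ as f)
  (List.filter-none (λ a → FinSet._≟_ E (α a) b) (ListAll.universal α≢b (elements D))))

-- Under an injective α the fibre over α(a) is the fibre of the identity over a.
fibreSum-injective : ∀ D E {α : ⌊ D ⌋ → ⌊ E ⌋} → Injective _≡_ _≡_ α → ∀ f a →
                     fibreSum D E α f (α a) ≈ℝ f a
fibreSum-injective D E {α} inj f a =
  ≈ℝ.trans {fibreSum D E α f (α a)} {∑ (filter (λ a′ → FinSet._≟_ D a′ a) (elements D)) f} {f a}
    (≡⇒≈ℝ (cong (λ as → ∑ as f)
      (List.filter-≐ (λ a′ → FinSet._≟_ E (α a′) (α a)) (λ a′ → FinSet._≟_ D a′ a)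
        ((λ eq → inj eq) , cong α) (elements D))))
    (fibreSum-id D f a)

module BLP = Minion BLP

Supported : ∀ {D} → Distribution D → (⌊ D ⌋ → Set) → Set
Supported μ P = ∀ a → ¬ P a → prob μ a ≈ℝ 0ℝ

module _ {D E : FinSet} where
  _⟪_⟫ : (⌊ D ⌋ → ⌊ E ⌋) → Distribution D → Distribution E
  α ⟪ μ ⟫ = BLP.map {D} {E} α μ

  supported-image : ∀ {P} {α : ⌊ D ⌋ → ⌊ E ⌋} (μ : Distribution D) → (∀ d → P (α d)) →
                    Supported (α ⟪ μ ⟫) P
  supported-image {P} {α} μ Pα b ¬Pb =
    fibreSum-empty D E α (prob μ) b (λ a eq → ¬Pb (subst P eq (Pα a)))

  -- A fibre sum dominates each of its nonnegative terms, so a fibre of mass 0 consists of points of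
  -- mass 0.
  supported-preimage : ∀ {P} {α : ⌊ D ⌋ → ⌊ E ⌋} (μ : Distribution D) →
                       Supported (α ⟪ μ ⟫) P → Supported μ (P ∘ α)
  supported-preimage {P} {α} μ supp a ¬Pαa =
    ≤ℝ-antisym {prob μ a} {0ℝ}
      (≤ℝ-trans {prob μ a} {prob (α ⟪ μ ⟫) (α a)} {0ℝ}
        (∈⇒≤∑ {f = prob μ} (Distribution.0≤ μ)
          (∈-filter⁺ (λ a′ → FinSet._≟_ E (α a′) (α a)) (complete D a) refl))
        (≈ℝ⇒≤ℝ {prob (α ⟪ μ ⟫) (α a)} {0ℝ} (supp (α a) ¬Pαa)))
      (Distribution.0≤ μ a)

  map-injective : ∀ {α : ⌊ D ⌋ → ⌊ E ⌋} → Injective _≡_ _≡_ α → (μ ν : Distribution D) →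
                  BLP._≈_ {E} (α ⟪ μ ⟫) (α ⟪ ν ⟫) → BLP._≈_ {D} μ ν
  map-injective {α} inj μ ν eq a =
    ≈ℝ.trans {prob μ a} {prob (α ⟪ μ ⟫) (α a)} {prob ν a}
      (≈ℝ.sym {prob (α ⟪ μ ⟫) (α a)} {prob μ a} (fibreSum-injective D E inj (prob μ) a))
      (≈ℝ.trans {prob (α ⟪ μ ⟫) (α a)} {prob (α ⟪ ν ⟫) (α a)} {prob ν a} (eq (α a))
        (fibreSum-injective D E inj (prob ν) a))

module _ {D : FinSet} {P : ⌊ D ⌋ → Set} (P? : Decidable P) (μ : Distribution D) (supp : Supported μ P) where
  private
    D∣P : FinSet
    D∣P = Subᶠ D P?

    -- At points of P the injectivity of `value` applies; elsewhere the fibre is empty and `supp`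
    -- gives mass 0 on the other side.
    fibreSum-value : ∀ b → fibreSum D∣P D value (prob μ ∘ value) b ≈ℝ prob μ b
    fibreSum-value b with P? b
    ... | yes Pb = fibreSum-injective D∣P D value-injective (prob μ ∘ value) (b , [ Pb ])
    ... | no ¬Pb =
      ≈ℝ.trans {fibreSum D∣P D value (prob μ ∘ value) b} {0ℝ} {prob μ b}
        (fibreSum-empty D∣P D value (prob μ ∘ value) b λ { (_ , [ p ]) refl → contradiction-irr p ¬Pb })
        (≈ℝ.sym {prob μ b} {0ℝ} (supp b ¬Pb))

  -- All mass lies in P, so restricting the probabilities keeps their total at 1.
  condition : Distribution D∣P
  condition = record
    { prob  = prob μ ∘ value
    ; 0≤    = Distribution.0≤ μ ∘ value
    ; ≤1    = Distribution.≤1 μ ∘ value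
    ; total =
        ≈ℝ.trans {∑ (elements D∣P) (prob μ ∘ value)}
                 {∑ (elements D) (fibreSum D∣P D value (prob μ ∘ value))} {1ℝ}
          (≈ℝ.sym {∑ (elements D) (fibreSum D∣P D value (prob μ ∘ value))}
                  {∑ (elements D∣P) (prob μ ∘ value)}
            (fibreSum-total D∣P D value (prob μ ∘ value)))
          (≈ℝ.trans {∑ (elements D) (fibreSum D∣P D value (prob μ ∘ value))}
                    {∑ (elements D) (prob μ)} {1ℝ}
            (∑-cong (elements D) {fibreSum D∣P D value (prob μ ∘ value)} {prob μ} fibreSum-value)
            (Distribution.total μ))
    }

  map-value-condition : BLP._≈_ {D} (BLP.map {D∣P} {D} value condition) μ
  map-value-condition = fibreSum-value

BLP-supports : SupportTheory BLP
BLP-supports = record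
  { Null                = λ μ a → prob μ a ≈ℝ 0ℝ
  ; supported-cong      = λ {D} {P} {μ} {ν} μ≈ν supp a ¬Pa →
      ≈ℝ.trans {prob ν a} {prob μ a} {0ℝ} (≈ℝ.sym {prob μ a} {prob ν a} (μ≈ν a)) (supp a ¬Pa)
  ; supported-image     = λ {D} {E} {P} {α} → supported-image {D} {E} {P} {α}
  ; supported-preimage  = λ {D} {E} {P} {α} → supported-preimage {D} {E} {P} {α}
  ; map-injective       = λ {D} {E} → map-injective {D} {E}
  ; condition           = condition
  ; map-value-condition = map-value-condition
  }

-- Arity bounds and the equivalence

maxArity : Signature → ℕ
maxArity 𝓢 = max 0 (List.map ar (elements Symbol))
  where open Signature 𝓢

ar≤maxArity : ∀ 𝓢 R → Signature.ar 𝓢 R ≤ maxArity 𝓢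
ar≤maxArity 𝓢 R = ListAll.lookup (xs≤max 0 (List.map ar (elements Symbol))) (∈-map⁺ ar (complete Symbol R))
  where open Signature 𝓢

corollary6p13 : ExcludedMiddle 0ℓ →
    (𝓣 : PCSPTemplate) → let open PCSPTemplate 𝓣 in
    (∃[ m ] 1 ≤ m × SolvedBySheraliAdams 𝓣 m) ⇔
    (∃[ k ] Σ[ k≥1 ∈ NonZero k ] MinionHom (lvl k {{k≥1}} BLP) (Pol 𝔸 𝔹))
corollary6p13 em 𝓣 = mk⇔
  (λ (m , _ , solver) → suc (m + maxArity 𝓢) , _ , hom m solver)
  -- The successor of the maximal arity is positive even for a signature without symbols, so
  -- singletons count as small and the Sherali-Adams level is at least 1.
  (λ { (suc j , _ , h) → suc j * suc (maxArity 𝓢) , s≤s z≤n , solver j h })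
  where
  open PCSPTemplate 𝓣

  hom : ∀ m → SolvedBySheraliAdams 𝓣 m → MinionHom (level (m + maxArity 𝓢) BLP) (Pol 𝔸 𝔹)
  hom m = FromSolver.minionHom BLP BLP-supports em 𝔸 𝔹 m (maxArity 𝓢) (ar≤maxArity 𝓢)

  solver : ∀ j → MinionHom (level j BLP) (Pol 𝔸 𝔹) → SolvedBySheraliAdams 𝓣 (suc j * suc (maxArity 𝓢))
  solver j h 𝓘 s = FromHom.instanceSolution 𝔸 𝓘 (suc (maxArity 𝓢)) BLP j s 𝔹 𝔸→𝔹
      (λ R → ℕ.m≤n⇒m≤1+n (ar≤maxArity 𝓢 R)) (s≤s z≤n) h
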